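{- Let $p = 3$ and let $q > 3$ be a prime number. Then the energy of the line graph $L(\Gamma(\mathbb{Z}_{3q}))$ is $4q-p-5$.
   Context: For a positive integer $n$, $\mathbb{Z}_n$ is the ring of residue classes modulo $n$. The zero-divisor graph $\Gamma(\mathbb{Z}_n)$ is the simple undirected graph whose vertices are the nonzero zero-divisors of $\mathbb{Z}_n$ (nonzero $x \in \mathbb{Z}_n$ such that $xy = 0$ for some nonzero $y \in \mathbb{Z}_n$), with distinct vertices $x,y$ adjacent if and only if $xy=0$. The line graph $L(\Gamma(\mathbb{Z}_n))$ is the graph whose vertices are the edges of $\Gamma(\mathbb{Z}_n)$, two distinct vertices being adjacent if the corresponding edges share a common vertex in $\Gamma(\mathbb{Z}_n)$. The energy of a finite graph is the sum of the absolute values of the eigenvalues (counted with multiplicity) of its adjacency matrix. -}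

module Defs where

open import Data.Bool.Base using (if_then_else_)
open import Data.Fin.Base using (Fin; toℕ) renaming (_<_ to _<ᶠ_)
open import Data.Fin.Properties using (nonZeroIndex; any?) renaming (_≟_ to _≟ᶠ_; _<?_ to _<ᶠ?_)
open import Data.Integer.Base using (ℤ; +_)
open import Data.List.Base using (List; allFin; cartesianProduct; filter; length; lookup)
open import Data.Nat.Base as ℕ using (ℕ)
import Data.Nat.Properties as ℕ
open import Data.Nat.DivMod using (_mod_)
open import Data.Product.Base using (_×_; _,_; ∃; ∃-syntax)
open import Data.Rational
open import Data.Rational.Properties
open import Data.Rational.Solver using (module +-*-Solver)
open import Data.Sum.Base using (_⊎_; inj₁; inj₂)
open import Data.Vec.Functional using (Vector; foldr)
open import Function.Bundles using (_⇔_)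
open import Relation.Binary.Core using (Rel)
open import Relation.Binary.Definitions using (Decidable; Irreflexive; Symmetric)
open import Relation.Binary.PropositionalEquality
  using (_≡_; _≢_; refl; sym; trans; cong; cong₂; subst)
open import Relation.Nullary using (¬_; Dec; does)
open import Relation.Nullary.Decidable using (¬?; _×-dec_; _⊎-dec_)
open import Level using (0ℓ)

-- The real numbers are Cauchy sequences of rationals, taken up to _≈ᴿ_.

IsCauchy : (ℕ → ℚ) → Set
IsCauchy x = ∀ ε → 0ℚ < ε →
  ∃[ N ] (∀ m n → N ℕ.≤ m → N ℕ.≤ n → ∣ x m - x n ∣ < ε)

record ℝ : Set where
  constructor mkℝ
  field
    seq    : ℕ → ℚ
    cauchy : IsCauchy seq

open ℝ public

infix 4 _≈ᴿ_

_≈ᴿ_ : Rel ℝ 0ℓ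
x ≈ᴿ y = ∀ ε → 0ℚ < ε →
  ∃[ N ] (∀ n → N ℕ.≤ n → ∣ seq x n - seq y n ∣ < ε)

abstract
  const-cauchy : ∀ r → IsCauchy (λ _ → r)
  const-cauchy r ε 0<ε = 0 , λ _ _ _ _ →
    subst (λ t → ∣ t ∣ < ε) (sym (+-inverseʳ r)) 0<ε

fromℚ : ℚ → ℝ
fromℚ r = mkℝ (λ _ → r) (const-cauchy r)

fromℤ : ℤ → ℝ
fromℤ i = fromℚ (i / 1)

0ℝ 1ℝ : ℝ
0ℝ = fromℤ (+ 0)
1ℝ = fromℤ (+ 1)

private
  module Identities where
    open +-*-Solver

    sub-add : ∀ a b → (a - b) + b ≡ a
    sub-add = solve 2 (λ a b → (a :- b) :+ b := a) refl

    add-sub : ∀ a b → (a + b) - b ≡ a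
    add-sub = solve 2 (λ a b → (a :+ b) :- b := a) refl

    neg-sub : ∀ a b → - (a - b) ≡ b - a
    neg-sub = solve 2 (λ a b → :- (a :- b) := b :- a) refl

    sub-interchange : ∀ a b c d → (a + b) - (c + d) ≡ (a - c) + (b - d)
    sub-interchange =
      solve 4 (λ a b c d → (a :+ b) :- (c :+ d) := (a :- c) :+ (b :- d)) refl

    product-sub : ∀ a b c d → a * b - c * d ≡ a * (b - d) + d * (a - c)
    product-sub =
      solve 4 (λ a b c d → a :* b :- c :* d := a :* (b :- d) :+ d :* (a :- c)) refl

  open Identities

  half-pos : ∀ {ε} → 0ℚ < ε → 0ℚ < ½ * ε
  half-pos {ε} 0<ε = positive⁻¹ (½ * ε) {{pos*pos⇒pos ½ ε {{positive 0<ε}}}}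

  half+half : ∀ ε → ½ * ε + ½ * ε ≡ ε
  half+half ε = trans (sym (*-distribʳ-+ ε ½ ½)) (*-identityˡ ε)

  shrink : ∀ b → 0ℚ < b → ∀ ε → 0ℚ < ε → ∃[ δ ] (0ℚ < δ × b * δ ≡ ε)
  shrink b 0<b ε 0<ε = 1/b * ε ,
    positive⁻¹ (1/b * ε) {{pos*pos⇒pos 1/b {{1/pos⇒pos b}} ε {{positive 0<ε}}}} ,
    trans (sym (*-assoc b 1/b ε))
      (trans (cong (_* ε) (*-inverseʳ b)) (*-identityˡ ε))
    where
    instance
      b-pos : Positive b
      b-pos = positive 0<b
      b-nonZero : NonZero b
      b-nonZero = pos⇒nonZero b
    1/b : ℚ
    1/b = 1/ b

  ∣p∣≤∣p-q∣+∣q∣ : ∀ p q → ∣ p ∣ ≤ ∣ p - q ∣ + ∣ q ∣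
  ∣p∣≤∣p-q∣+∣q∣ p q =
    subst (λ t → ∣ t ∣ ≤ ∣ p - q ∣ + ∣ q ∣)
      (sub-add p q)
      (∣p+q∣≤∣p∣+∣q∣ (p - q) q)

  ∣p-q∣≡∣q-p∣ : ∀ p q → ∣ p - q ∣ ≡ ∣ q - p ∣
  ∣p-q∣≡∣q-p∣ p q = trans (sym (∣-p∣≡∣p∣ (p - q)))
    (cong ∣_∣ (neg-sub p q))

  ∣p∣-∣q∣≤∣p-q∣ : ∀ p q → ∣ p ∣ - ∣ q ∣ ≤ ∣ p - q ∣
  ∣p∣-∣q∣≤∣p-q∣ p q = begin
    ∣ p ∣ - ∣ q ∣                ≤⟨ +-monoˡ-≤ (- ∣ q ∣) (∣p∣≤∣p-q∣+∣q∣ p q) ⟩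
    ∣ p - q ∣ + ∣ q ∣ - ∣ q ∣    ≡⟨ add-sub ∣ p - q ∣ ∣ q ∣ ⟩
    ∣ p - q ∣                    ∎
    where
    open ≤-Reasoning

  ∣∣p∣-∣q∣∣≤∣p-q∣ : ∀ p q → ∣ ∣ p ∣ - ∣ q ∣ ∣ ≤ ∣ p - q ∣
  ∣∣p∣-∣q∣∣≤∣p-q∣ p q with ∣p∣≡p∨∣p∣≡-p (∣ p ∣ - ∣ q ∣)
  ... | inj₁ eq = subst (_≤ ∣ p - q ∣) (sym eq) (∣p∣-∣q∣≤∣p-q∣ p q)
  ... | inj₂ eq = begin
    ∣ ∣ p ∣ - ∣ q ∣ ∣    ≡⟨ eq ⟩
    - (∣ p ∣ - ∣ q ∣)    ≡⟨ neg-sub ∣ p ∣ ∣ q ∣ ⟩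
    ∣ q ∣ - ∣ p ∣        ≤⟨ ∣p∣-∣q∣≤∣p-q∣ q p ⟩
    ∣ q - p ∣            ≡⟨ ∣p-q∣≡∣q-p∣ q p ⟩
    ∣ p - q ∣            ∎
    where
    open ≤-Reasoning

  bounded : ∀ x → ∃[ b ] (0ℚ < b × ∃[ N ] (∀ n → N ℕ.≤ n → ∣ seq x n ∣ ≤ b))
  bounded x with cauchy x 1ℚ (positive⁻¹ 1ℚ)
  ... | N , close = 1ℚ + ∣ seq x N ∣ ,
    +-mono-<-≤ (positive⁻¹ 1ℚ) (0≤∣p∣ (seq x N)) ,
    N , λ n N≤n → ≤-trans (∣p∣≤∣p-q∣+∣q∣ (seq x n) (seq x N))
      (+-monoˡ-≤ ∣ seq x N ∣ (<⇒≤ (close n N N≤n ℕ.≤-refl)))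

  product-close : ∀ {a b a′ b′ B C δ η} → ∣ a ∣ ≤ B → ∣ b′ ∣ ≤ C →
    0ℚ < B → 0ℚ < C → ∣ b - b′ ∣ < δ → ∣ a - a′ ∣ < η →
    ∣ a * b - a′ * b′ ∣ < B * δ + C * η
  product-close {a} {b} {a′} {b′} {B} {C} {δ} {η} a≤B b′≤C 0<B 0<C b-close a-close =
    begin-strict
    ∣ a * b - a′ * b′ ∣                    ≡⟨ cong ∣_∣ (product-sub a b a′ b′) ⟩
    ∣ a * (b - b′) + b′ * (a - a′) ∣       ≤⟨ ∣p+q∣≤∣p∣+∣q∣ (a * (b - b′)) (b′ * (a - a′)) ⟩
    ∣ a * (b - b′) ∣ + ∣ b′ * (a - a′) ∣   ≡⟨ cong₂ _+_ (∣p*q∣≡∣p∣*∣q∣ a (b - b′)) (∣p*q∣≡∣p∣*∣q∣ b′ (a - a′)) ⟩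
    ∣ a ∣ * ∣ b - b′ ∣ + ∣ b′ ∣ * ∣ a - a′ ∣ <⟨ +-mono-< (bound a≤B 0<B b-close) (bound b′≤C 0<C a-close) ⟩
    B * δ + C * η                          ∎
    where
    open ≤-Reasoning
    bound : ∀ {u v K κ} → ∣ u ∣ ≤ K → 0ℚ < K → ∣ v ∣ < κ → ∣ u ∣ * ∣ v ∣ < K * κ
    bound {u} {v} {K} u≤K 0<K v<κ = ≤-<-trans
      (*-monoʳ-≤-nonNeg ∣ v ∣ {{nonNegative (0≤∣p∣ v)}} u≤K)
      (*-monoʳ-<-pos K {{positive 0<K}} v<κ)

-- The moduli of convergence are irrelevant to _≈ᴿ_, hence abstract.
abstract
  +-cauchy : ∀ x y → IsCauchy (λ n → seq x n + seq y n)
  +-cauchy x y ε 0<ε with cauchy x (½ * ε) (half-pos 0<ε) | cauchy y (½ * ε) (half-pos 0<ε)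
  ... | M , close-x | N , close-y = M ℕ.⊔ N , λ m n ≤m ≤n → begin-strict
    ∣ (seq x m + seq y m) - (seq x n + seq y n) ∣
      ≡⟨ cong ∣_∣ (sub-interchange (seq x m) (seq y m) (seq x n) (seq y n)) ⟩
    ∣ (seq x m - seq x n) + (seq y m - seq y n) ∣
      ≤⟨ ∣p+q∣≤∣p∣+∣q∣ (seq x m - seq x n) (seq y m - seq y n) ⟩
    ∣ seq x m - seq x n ∣ + ∣ seq y m - seq y n ∣
      <⟨ +-mono-< (close-x m n (ℕ.m⊔n≤o⇒m≤o M N ≤m) (ℕ.m⊔n≤o⇒m≤o M N ≤n))
                  (close-y m n (ℕ.m⊔n≤o⇒n≤o M N ≤m) (ℕ.m⊔n≤o⇒n≤o M N ≤n)) ⟩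
    ½ * ε + ½ * ε
      ≡⟨ half+half ε ⟩
    ε ∎
    where open ≤-Reasoning

  *-cauchy : ∀ x y → IsCauchy (λ n → seq x n * seq y n)
  *-cauchy x y ε 0<ε =
    let (B , 0<B , M₁ , x≤B) = bounded x
        (C , 0<C , M₂ , y≤C) = bounded y
        (δ , 0<δ , Bδ≡) = shrink B 0<B (½ * ε) (half-pos 0<ε)
        (η , 0<η , Cη≡) = shrink C 0<C (½ * ε) (half-pos 0<ε)
        (N₁ , close-y) = cauchy y δ 0<δ
        (N₂ , close-x) = cauchy x η 0<η
    in M₁ ℕ.+ M₂ ℕ.+ (N₁ ℕ.+ N₂) , λ m n ≤m ≤n →
      subst (∣ seq x m * seq y m - seq x n * seq y n ∣ <_)
        (trans (cong₂ _+_ Bδ≡ Cη≡) (half+half ε))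
        (product-close {a = seq x m} {seq y m} {seq x n} {seq y n} {B} {C} {δ} {η}
          (x≤B m (ℕ.m+n≤o⇒m≤o M₁ (ℕ.m+n≤o⇒m≤o (M₁ ℕ.+ M₂) ≤m)))
          (y≤C n (ℕ.m+n≤o⇒n≤o M₁ (ℕ.m+n≤o⇒m≤o (M₁ ℕ.+ M₂) ≤n)))
          0<B 0<C
          (close-y m n (ℕ.m+n≤o⇒m≤o N₁ (ℕ.m+n≤o⇒n≤o (M₁ ℕ.+ M₂) ≤m))
                       (ℕ.m+n≤o⇒m≤o N₁ (ℕ.m+n≤o⇒n≤o (M₁ ℕ.+ M₂) ≤n)))
          (close-x m n (ℕ.m+n≤o⇒n≤o N₁ (ℕ.m+n≤o⇒n≤o (M₁ ℕ.+ M₂) ≤m))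
                       (ℕ.m+n≤o⇒n≤o N₁ (ℕ.m+n≤o⇒n≤o (M₁ ℕ.+ M₂) ≤n))))

  ∣∣-cauchy : ∀ x → IsCauchy (λ n → ∣ seq x n ∣)
  ∣∣-cauchy x ε 0<ε with cauchy x ε 0<ε
  ... | N , close = N , λ m n N≤m N≤n →
    ≤-<-trans (∣∣p∣-∣q∣∣≤∣p-q∣ (seq x m) (seq x n)) (close m n N≤m N≤n)

infixl 6 _+ᴿ_
infixl 7 _*ᴿ_

_+ᴿ_ : ℝ → ℝ → ℝ
x +ᴿ y = mkℝ (λ n → seq x n + seq y n) (+-cauchy x y)

_*ᴿ_ : ℝ → ℝ → ℝ
x *ᴿ y = mkℝ (λ n → seq x n * seq y n) (*-cauchy x y)

∣_∣ᴿ : ℝ → ℝ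
∣ x ∣ᴿ = mkℝ (λ n → ∣ seq x n ∣) (∣∣-cauchy x)

∑ : ∀ {n} → Vector ℝ n → ℝ
∑ = foldr _+ᴿ_ 0ℝ

Matrix : ℕ → Set
Matrix n = Fin n → Fin n → ℝ

infix 4 _≈ᵛ_
infixr 7 _·ᵛ_ _·ᴹ_

_≈ᵛ_ : ∀ {n} → Rel (Vector ℝ n) 0ℓ
v ≈ᵛ w = ∀ i → v i ≈ᴿ w i

0ᵛ : ∀ {n} → Vector ℝ n
0ᵛ _ = 0ℝ

_·ᵛ_ : ∀ {n} → ℝ → Vector ℝ n → Vector ℝ n
(c ·ᵛ v) i = c *ᴿ v i

_·ᴹ_ : ∀ {n} → Matrix n → Vector ℝ n → Vector ℝ n
(A ·ᴹ v) i = ∑ λ j → A i j *ᴿ v j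

linComb : ∀ {d n} → Vector ℝ d → (Fin d → Vector ℝ n) → Vector ℝ n
linComb c b i = ∑ λ k → c k *ᴿ b k i

Eigenspace : ∀ {n} → Matrix n → ℝ → Vector ℝ n → Set
Eigenspace A μ v = A ·ᴹ v ≈ᵛ μ ·ᵛ v

IsEigenvalue : ∀ {n} → Matrix n → ℝ → Set
IsEigenvalue A μ = ∃[ v ] (¬ (v ≈ᵛ 0ᵛ) × Eigenspace A μ v)

record IsBasis {d n} (V : Vector ℝ n → Set) (b : Fin d → Vector ℝ n) : Set where
  field
    member      : ∀ k → V (b k)
    independent : ∀ c → linComb c b ≈ᵛ 0ᵛ → c ≈ᵛ 0ᵛ
    spanning    : ∀ v → V v → ∃[ c ] (v ≈ᵛ linComb c b)

HasDimension : ∀ {n} → (Vector ℝ n → Set) → ℕ → Set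
HasDimension {n} V d = ∃ λ (b : Fin d → Vector ℝ n) → IsBasis V b

-- The spectrum of A: its pairwise distinct real eigenvalues, each with the
-- dimension of its eigenspace.  For the real symmetric matrices to which this
-- is applied all complex eigenvalues are real, and the algebraic and geometric
-- multiplicities agree.
record Spectrum {n} (A : Matrix n) : Set where
  field
    size         : ℕ
    eigenvalue   : Fin size → ℝ
    multiplicity : Fin size → ℕ
    distinct     : ∀ {i j} → i ≢ j → ¬ (eigenvalue i ≈ᴿ eigenvalue j)
    complete     : ∀ μ → IsEigenvalue A μ ⇔ (∃[ i ] μ ≈ᴿ eigenvalue i)
    dimension    : ∀ i → HasDimension (Eigenspace A (eigenvalue i)) (multiplicity i)

sumOfAbsoluteValues : ∀ {n} {A : Matrix n} → Spectrum A → ℝ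
sumOfAbsoluteValues S = ∑ λ i → fromℤ (+ multiplicity i) *ᴿ ∣ eigenvalue i ∣ᴿ
  where open Spectrum S

record Graph : Set₁ where
  field
    order  : ℕ
    Adj    : Rel (Fin order) 0ℓ
    adj?   : Decidable Adj
    symm   : Symmetric Adj
    irrefl : Irreflexive _≡_ Adj

open Graph public using (order)

adjacencyMatrix : (G : Graph) → Matrix (order G)
adjacencyMatrix G i j = if does (Graph.adj? G i j) then 1ℝ else 0ℝ

-- Eigenvalues and dimensions of eigenspaces being invariants of the matrix, G
-- has, up to _≈ᴿ_, at most one energy.
HasEnergy : Graph → ℝ → Set
HasEnergy G E = ∃ λ (S : Spectrum (adjacencyMatrix G)) → sumOfAbsoluteValues S ≈ᴿ E

-- The vertices are the edges of G, the edge {i , j} with i < j being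
-- represented by the pair (i , j); each edge occurs once in `edges`.
module _ (G : Graph) where
  open Graph G using (Adj; adj?)

  edges : List (Fin (order G) × Fin (order G))
  edges = filter (λ (i , j) → (i <ᶠ? j) ×-dec adj? i j)
    (cartesianProduct (allFin (order G)) (allFin (order G)))

  ShareVertex : Rel (Fin (order G) × Fin (order G)) 0ℓ
  ShareVertex (i , j) (k , l) = (i ≡ k ⊎ i ≡ l) ⊎ (j ≡ k ⊎ j ≡ l)

  shareVertex? : Decidable ShareVertex
  shareVertex? (i , j) (k , l) =
    ((i ≟ᶠ k) ⊎-dec (i ≟ᶠ l)) ⊎-dec ((j ≟ᶠ k) ⊎-dec (j ≟ᶠ l))

  shareVertex-sym : Symmetric ShareVertex
  shareVertex-sym (inj₁ (inj₁ eq)) = inj₁ (inj₁ (sym eq))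
  shareVertex-sym (inj₁ (inj₂ eq)) = inj₂ (inj₁ (sym eq))
  shareVertex-sym (inj₂ (inj₁ eq)) = inj₁ (inj₂ (sym eq))
  shareVertex-sym (inj₂ (inj₂ eq)) = inj₂ (inj₂ (sym eq))

  lineGraph : Graph
  lineGraph = record
    { order  = length edges
    ; Adj    = λ e f → e ≢ f × ShareVertex (lookup edges e) (lookup edges f)
    ; adj?   = λ e f → ¬? (e ≟ᶠ f) ×-dec shareVertex? (lookup edges e) (lookup edges f)
    ; symm   = λ (e≢f , share) → (λ f≡e → e≢f (sym f≡e)) , shareVertex-sym share
    ; irrefl = λ e≡f (e≢f , _) → e≢f e≡f
    }

-- ℤ/nℤ is represented by the residues Fin n.
_*ₙ_ : ∀ {n} → Fin n → Fin n → Fin n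
_*ₙ_ {n} x y = _mod_ (toℕ x ℕ.* toℕ y) n {{nonZeroIndex x}}

IsZero : ∀ {n} → Fin n → Set
IsZero x = toℕ x ≡ 0

IsNonzeroZeroDivisor : ∀ {n} → Fin n → Set
IsNonzeroZeroDivisor x = ¬ IsZero x × ∃[ y ] (¬ IsZero y × IsZero (x *ₙ y))

isZero? : ∀ {n} (x : Fin n) → Dec (IsZero x)
isZero? x = toℕ x ℕ.≟ 0

isNonzeroZeroDivisor? : ∀ {n} (x : Fin n) → Dec (IsNonzeroZeroDivisor x)
isNonzeroZeroDivisor? x =
  ¬? (isZero? x) ×-dec any? λ y → ¬? (isZero? y) ×-dec isZero? (x *ₙ y)

*ₙ-comm : ∀ {n} (x y : Fin n) → x *ₙ y ≡ y *ₙ x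
*ₙ-comm {n} x y = cong (λ k → _mod_ k n {{nonZeroIndex x}}) (ℕ.*-comm (toℕ x) (toℕ y))

nonzeroZeroDivisors : ∀ n → List (Fin n)
nonzeroZeroDivisors n = filter isNonzeroZeroDivisor? (allFin n)

zeroDivisorGraph : ℕ → Graph
zeroDivisorGraph n = record
  { order  = length vs
  ; Adj    = λ i j → i ≢ j × IsZero (lookup vs i *ₙ lookup vs j)
  ; adj?   = λ i j → ¬? (i ≟ᶠ j) ×-dec isZero? (lookup vs i *ₙ lookup vs j)
  ; symm   = λ {i} {j} (i≢j , xy≡0) →
      (λ j≡i → i≢j (sym j≡i)) , subst IsZero (*ₙ-comm (lookup vs i) (lookup vs j)) xy≡0
  ; irrefl = λ i≡j (i≢j , _) → i≢j i≡j
  }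
  where
  vs : List (Fin n)
  vs = nonzeroZeroDivisors n

{-# OPTIONS --safe #-}

-- For a prime q > 3, the nonzero zero divisors of ℤ/3q are the multiples of q and the
-- multiples of 3, and Γ(ℤ/3q) is the complete bipartite graph K(2, m) with m = q − 1.  Its
-- line graph is the 2 × m rook's graph.  On a vector with rows x and y, the adjacency matrix
-- A satisfies A v = μ v only if, for s = 1 and s = −1, the folded row u = x + s y satisfies
-- (μ + 1 − s) u = (∑ u) 1, that is, u is an eigenvector of the all-ones matrix J for
-- μ + 1 − s; conversely an eigenvector z of J for t unfolds to the eigenvector (z, s z) of A
-- for t + s − 1.  As J has the eigenvalues m and 0 with multiplicities 1 and m − 1, those
-- of A are m, m − 2 (simple), 0 and −2 (of multiplicity m − 1), and the energy is
-- m + (m − 2) + 2 (m − 1) = 4 q − 8.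
module Submission where

open import Defs
open import Algebra.Bundles using (CommutativeRing)
open import Data.Bool.Base using (if_then_else_)
open import Data.Fin.Base using (Fin; zero; suc; toℕ; fromℕ<; combine; _↑ˡ_; _↑ʳ_)
  renaming (_<_ to _<ᶠ_)
open import Data.Fin.Properties
  using (suc-injective; toℕ-injective; toℕ-fromℕ<; toℕ<n; nonZeroIndex; <-cmp; *↔×)
  renaming (_≟_ to _≟ᶠ_; _<?_ to _<ᶠ?_)
open import Data.Integer.Base as ℤ using (ℤ; +_; -[1+_]; _-_)
import Data.Integer.Properties as ℤ
open import Data.List.Base using (List; allFin; cartesianProduct; length; lookup)
open import Data.List.Membership.Propositional using (_∈_)
open import Data.List.Membership.Propositional.Properties
  using (∈-lookup; ∈-filter⁺; ∈-filter⁻; ∈-allFin; ∈-cartesianProduct⁺)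
import Data.List.Relation.Unary.All as All
open import Data.List.Relation.Unary.AllPairs using (_∷_)
import Data.List.Relation.Unary.Any as Any
open import Data.List.Relation.Unary.Any.Properties using (lookup-index)
open import Data.List.Relation.Unary.Unique.Propositional using (Unique)
open import Data.List.Relation.Unary.Unique.Propositional.Properties
  using (allFin⁺; cartesianProduct⁺; filter⁺)
open import Data.Nat.Base as ℕ using (ℕ; zero; suc; _*_; _<_; s≤s; z≤n)
open import Data.Nat.Divisibility
  using (_∣_; divides; ∣⇒≤; *-monoʳ-∣; *-monoˡ-∣; m∣m*n; ∣-trans; m*n∣⇒m∣; m*n∣⇒n∣;
         m%n≡0⇒n∣m; n∣m⇒m%n≡0)
open import Data.Nat.DivMod using (m%n<n)
open import Data.Nat.Primality
  using (Prime; prime?; euclidsLemma; prime⇒irreducible; prime⇒nonZero)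
import Data.Nat.Properties as ℕ
open import Data.Product.Base using (_×_; _,_; proj₁; proj₂; ∃-syntax; map₂; uncurry)
open import Data.Rational.Base as ℚ using (ℚ; 0ℚ; 1ℚ; ½; toℚᵘ)
import Data.Rational.Properties as ℚ
open import Data.Rational.Solver using (module +-*-Solver)
import Data.Rational.Unnormalised.Base as ℚᵘ
import Data.Rational.Unnormalised.Properties as ℚᵘ
open import Data.Sum.Base using (_⊎_; inj₁; inj₂; [_,_]′)
open import Data.Vec.Functional using (Vector)
open import Function.Base using (_∘_)
open import Function.Bundles using (_↔_; Inverse; mk⇔; mk↔ₛ′)
open import Function.Construct.Composition using (_↔-∘_)
open import Function.Construct.Symmetry using (↔-sym)
open import Function.Definitions using (Injective)
open import Level using (0ℓ)
open import Relation.Binary.Definitions using (tri<; tri≈; tri>)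
open import Relation.Binary.PropositionalEquality
  using (_≡_; _≢_; refl; sym; trans; cong; cong₂; subst; subst₂; module ≡-Reasoning)
import Relation.Binary.Reasoning.Setoid as SetoidReasoning
open import Relation.Nullary using (¬_; Dec; yes; no; contradiction; does)
open import Relation.Nullary.Decidable
  using (decidable-stable; dec-true; dec-false; from-yes; _×-dec_)

open +-*-Solver using (solve; con; _:+_; _:*_; _:-_; :-_; _:=_)

-- Real numbers

half-positive : ∀ {ε} → 0ℚ ℚ.< ε → 0ℚ ℚ.< ½ ℚ.* ε
half-positive {ε} 0<ε = ℚ.positive⁻¹ (½ ℚ.* ε) {{ℚ.pos*pos⇒pos ½ ε {{ℚ.positive 0<ε}}}}

half+half : ∀ ε → ½ ℚ.* ε ℚ.+ ½ ℚ.* ε ≡ ε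
half+half = solve 1 (λ ε → con ½ :* ε :+ con ½ :* ε := ε) refl

∣-∣-comm : ∀ a b → ℚ.∣ a ℚ.- b ∣ ≡ ℚ.∣ b ℚ.- a ∣
∣-∣-comm a b = trans (sym (ℚ.∣-p∣≡∣p∣ (a ℚ.- b)))
  (cong ℚ.∣_∣ (solve 2 (λ a b → :- (a :- b) := b :- a) refl a b))

∣-∣-triangle : ∀ a b c → ℚ.∣ a ℚ.- c ∣ ℚ.≤ ℚ.∣ a ℚ.- b ∣ ℚ.+ ℚ.∣ b ℚ.- c ∣
∣-∣-triangle a b c = subst (λ t → ℚ.∣ t ∣ ℚ.≤ ℚ.∣ a ℚ.- b ∣ ℚ.+ ℚ.∣ b ℚ.- c ∣)
  (solve 3 (λ a b c → (a :- b) :+ (b :- c) := a :- c) refl a b c)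
  (ℚ.∣p+q∣≤∣p∣+∣q∣ (a ℚ.- b) (b ℚ.- c))

∣∣-triangle : ∀ a b → ℚ.∣ a ∣ ℚ.≤ ℚ.∣ a ℚ.- b ∣ ℚ.+ ℚ.∣ b ∣
∣∣-triangle a b = subst (λ t → ℚ.∣ t ∣ ℚ.≤ ℚ.∣ a ℚ.- b ∣ ℚ.+ ℚ.∣ b ∣)
  (solve 2 (λ a b → (a :- b) :+ b := a) refl a b)
  (ℚ.∣p+q∣≤∣p∣+∣q∣ (a ℚ.- b) b)

Null : (ℕ → ℚ) → Set
Null s = ∀ ε → 0ℚ ℚ.< ε → ∃[ N ] (∀ n → N ℕ.≤ n → ℚ.∣ s n ∣ ℚ.< ε)

Bounded : (ℕ → ℚ) → Set
Bounded s = ∃[ b ] (0ℚ ℚ.< b × ∃[ N ] (∀ n → N ℕ.≤ n → ℚ.∣ s n ∣ ℚ.≤ b))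

null-resp : ∀ {s t} → (∀ n → t n ≡ s n) → Null s → Null t
null-resp eq null ε 0<ε = map₂
  (λ small n N≤n → subst (λ r → ℚ.∣ r ∣ ℚ.< ε) (sym (eq n)) (small n N≤n)) (null ε 0<ε)

null-0 : Null (λ _ → 0ℚ)
null-0 ε 0<ε = 0 , λ _ _ → 0<ε

null-neg : ∀ {s} → Null s → Null (λ n → ℚ.- s n)
null-neg {s} null ε 0<ε = map₂
  (λ small n N≤n → subst (ℚ._< ε) (sym (ℚ.∣-p∣≡∣p∣ (s n))) (small n N≤n)) (null ε 0<ε)

null-+ : ∀ {s t} → Null s → Null t → Null (λ n → s n ℚ.+ t n)
null-+ {s} {t} null-s null-t ε 0<ε
  with null-s (½ ℚ.* ε) (half-positive 0<ε) | null-t (½ ℚ.* ε) (half-positive 0<ε)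
... | M , small-s | N , small-t = M ℕ.⊔ N , λ n ≤n → begin-strict
  ℚ.∣ s n ℚ.+ t n ∣          ≤⟨ ℚ.∣p+q∣≤∣p∣+∣q∣ (s n) (t n) ⟩
  ℚ.∣ s n ∣ ℚ.+ ℚ.∣ t n ∣    <⟨ ℚ.+-mono-< (small-s n (ℕ.m⊔n≤o⇒m≤o M N ≤n))
                                           (small-t n (ℕ.m⊔n≤o⇒n≤o M N ≤n)) ⟩
  ½ ℚ.* ε ℚ.+ ½ ℚ.* ε        ≡⟨ half+half ε ⟩
  ε                          ∎
  where open ℚ.≤-Reasoning

null-* : ∀ {s t} → Bounded s → Null t → Null (λ n → s n ℚ.* t n)
null-* {s} {t} (b , 0<b , M , s≤b) null ε 0<ε with null 1/b*ε 0<1/b*ε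
  where
  1/b*ε : ℚ
  1/b*ε = (ℚ.1/ b) {{ℚ.pos⇒nonZero b {{ℚ.positive 0<b}}}} ℚ.* ε
  0<1/b*ε : 0ℚ ℚ.< 1/b*ε
  0<1/b*ε = ℚ.positive⁻¹ 1/b*ε
    {{ℚ.pos*pos⇒pos ((ℚ.1/ b) {{ℚ.pos⇒nonZero b {{ℚ.positive 0<b}}}})
      {{ℚ.1/pos⇒pos b {{ℚ.positive 0<b}}}} ε {{ℚ.positive 0<ε}}}}
... | N , small = M ℕ.⊔ N , λ n ≤n → begin-strict
  ℚ.∣ s n ℚ.* t n ∣                ≡⟨ ℚ.∣p*q∣≡∣p∣*∣q∣ (s n) (t n) ⟩
  ℚ.∣ s n ∣ ℚ.* ℚ.∣ t n ∣          ≤⟨ ℚ.*-monoʳ-≤-nonNeg ℚ.∣ t n ∣ {{ℚ.∣-∣-nonNeg (t n)}}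
                                        (s≤b n (ℕ.m⊔n≤o⇒m≤o M N ≤n)) ⟩
  b ℚ.* ℚ.∣ t n ∣                  <⟨ ℚ.*-monoʳ-<-pos b (small n (ℕ.m⊔n≤o⇒n≤o M N ≤n)) ⟩
  b ℚ.* (ℚ.1/ b ℚ.* ε)             ≡⟨ ℚ.*-assoc b (ℚ.1/ b) ε ⟨
  b ℚ.* ℚ.1/ b ℚ.* ε               ≡⟨ cong (ℚ._* ε) (ℚ.*-inverseʳ b) ⟩
  1ℚ ℚ.* ε                         ≡⟨ ℚ.*-identityˡ ε ⟩
  ε                                ∎
  where
  open ℚ.≤-Reasoning
  instance
    b-positive : ℚ.Positive b
    b-positive = ℚ.positive 0<b
    b-nonZero : ℚ.NonZero b
    b-nonZero = ℚ.pos⇒nonZero b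

seq-bounded : ∀ x → Bounded (seq x)
seq-bounded x with cauchy x 1ℚ (ℚ.positive⁻¹ 1ℚ)
... | N , close = 1ℚ ℚ.+ ℚ.∣ seq x N ∣ ,
  ℚ.+-mono-<-≤ (ℚ.positive⁻¹ 1ℚ) (ℚ.0≤∣p∣ (seq x N)) ,
  N , λ n N≤n → ℚ.≤-trans (∣∣-triangle (seq x n) (seq x N))
    (ℚ.+-monoˡ-≤ ℚ.∣ seq x N ∣ (ℚ.<⇒≤ (close n N N≤n ℕ.≤-refl)))

infix 4 _≃_

-- _≈ᴿ_ unfolds to a statement about sequences from which its arguments cannot be
-- inferred; the record keeps them visible.
record _≃_ (x y : ℝ) : Set where
  constructor wrap
  field unwrap : x ≈ᴿ y

open _≃_

pointwise : ∀ {x y} → (∀ n → seq x n ≡ seq y n) → x ≃ y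
pointwise {x} {y} eq = wrap (null-resp
  (λ n → trans (cong (ℚ._- seq y n) (eq n)) (ℚ.+-inverseʳ (seq y n))) null-0)

-- To derive e ≃ f, exhibit e − f as a linear combination of the differences of the two
-- sides of known equations; the identity required is one between rationals.
by-combination₁ : ∀ {a b e f} (k : ℝ) → a ≃ b →
  (∀ n → seq e n ℚ.- seq f n ≡ seq k n ℚ.* (seq a n ℚ.- seq b n)) → e ≃ f
by-combination₁ k (wrap a≈b) identity =
  wrap (null-resp identity (null-* (seq-bounded k) a≈b))

by-combination₂ : ∀ {a b c d e f} (k l : ℝ) → a ≃ b → c ≃ d →
  (∀ n → seq e n ℚ.- seq f n ≡
    seq k n ℚ.* (seq a n ℚ.- seq b n) ℚ.+ seq l n ℚ.* (seq c n ℚ.- seq d n)) → e ≃ f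
by-combination₂ k l (wrap a≈b) (wrap c≈d) identity = wrap (null-resp identity
  (null-+ (null-* (seq-bounded k) a≈b) (null-* (seq-bounded l) c≈d)))

by-combination₃ : ∀ {a b c d g h e f} (k l m : ℝ) → a ≃ b → c ≃ d → g ≃ h →
  (∀ n → seq e n ℚ.- seq f n ≡
    seq k n ℚ.* (seq a n ℚ.- seq b n) ℚ.+ seq l n ℚ.* (seq c n ℚ.- seq d n)
      ℚ.+ seq m n ℚ.* (seq g n ℚ.- seq h n)) → e ≃ f
by-combination₃ k l m (wrap a≈b) (wrap c≈d) (wrap g≈h) identity = wrap (null-resp identity
  (null-+ (null-+ (null-* (seq-bounded k) a≈b) (null-* (seq-bounded l) c≈d))
          (null-* (seq-bounded m) g≈h)))

-1ℝ : ℝ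
-1ℝ = fromℤ -[1+ 0 ]

infixl 6 _-ᴿ_

_-ᴿ_ : ℝ → ℝ → ℝ
x -ᴿ y = x +ᴿ -1ℝ *ᴿ y

≃-refl : ∀ {x} → x ≃ x
≃-refl = pointwise (λ _ → refl)

≃-sym : ∀ {x y} → x ≃ y → y ≃ x
≃-sym {x} {y} (wrap x≈y) = wrap (null-resp
  (λ n → solve 2 (λ x y → y :- x := :- (x :- y)) refl (seq x n) (seq y n)) (null-neg x≈y))

≃-trans : ∀ {x y z} → x ≃ y → y ≃ z → x ≃ z
≃-trans {x} {y} {z} (wrap x≈y) (wrap y≈z) = wrap (null-resp
  (λ n → solve 3 (λ x y z → x :- z := (x :- y) :+ (y :- z)) refl (seq x n) (seq y n) (seq z n))
  (null-+ x≈y y≈z))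

+ᴿ-cong : ∀ {x y u v} → x ≃ y → u ≃ v → x +ᴿ u ≃ y +ᴿ v
+ᴿ-cong {x} {y} {u} {v} (wrap x≈y) (wrap u≈v) = wrap (null-resp
  (λ n → solve 4 (λ x y u v → (x :+ u) :- (y :+ v) := (x :- y) :+ (u :- v)) refl
    (seq x n) (seq y n) (seq u n) (seq v n))
  (null-+ x≈y u≈v))

*ᴿ-cong : ∀ {x y u v} → x ≃ y → u ≃ v → x *ᴿ u ≃ y *ᴿ v
*ᴿ-cong {x} {y} {u} {v} (wrap x≈y) (wrap u≈v) = wrap (null-resp
  (λ n → solve 4 (λ x y u v → x :* u :- y :* v := x :* (u :- v) :+ v :* (x :- y)) refl
    (seq x n) (seq y n) (seq u n) (seq v n))
  (null-+ (null-* (seq-bounded x) u≈v) (null-* (seq-bounded v) x≈y)))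

ℝ-commutativeRing : CommutativeRing 0ℓ 0ℓ
ℝ-commutativeRing = record
  { Carrier = ℝ
  ; _≈_ = _≃_
  ; _+_ = _+ᴿ_
  ; _*_ = _*ᴿ_
  ; -_ = -1ℝ *ᴿ_
  ; 0# = 0ℝ
  ; 1# = 1ℝ
  ; isCommutativeRing = record
    { isRing = record
      { +-isAbelianGroup = record
        { isGroup = record
          { isMonoid = record
            { isSemigroup = record
              { isMagma = record
                { isEquivalence = record { refl = ≃-refl ; sym = ≃-sym ; trans = ≃-trans }
                ; ∙-cong = +ᴿ-cong
                }
              ; assoc = λ x y z → pointwise λ n → ℚ.+-assoc (seq x n) (seq y n) (seq z n)
              }
            ; identity = (λ x → pointwise λ n → ℚ.+-identityˡ (seq x n)) ,
                         (λ x → pointwise λ n → ℚ.+-identityʳ (seq x n))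
            }
          ; inverse =
              (λ x → pointwise λ n →
                solve 1 (λ x → con (ℚ.- 1ℚ) :* x :+ x := con 0ℚ) refl (seq x n)) ,
              (λ x → pointwise λ n →
                solve 1 (λ x → x :+ con (ℚ.- 1ℚ) :* x := con 0ℚ) refl (seq x n))
          ; ⁻¹-cong = *ᴿ-cong ≃-refl
          }
        ; comm = λ x y → pointwise λ n → ℚ.+-comm (seq x n) (seq y n)
        }
      ; *-cong = *ᴿ-cong
      ; *-assoc = λ x y z → pointwise λ n → ℚ.*-assoc (seq x n) (seq y n) (seq z n)
      ; *-identity = (λ x → pointwise λ n → ℚ.*-identityˡ (seq x n)) ,
                     (λ x → pointwise λ n → ℚ.*-identityʳ (seq x n))
      ; distrib =
          (λ x y z → pointwise λ n → ℚ.*-distribˡ-+ (seq x n) (seq y n) (seq z n)) ,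
          (λ x y z → pointwise λ n → ℚ.*-distribʳ-+ (seq x n) (seq y n) (seq z n))
      }
    ; *-comm = λ x y → pointwise λ n → ℚ.*-comm (seq x n) (seq y n)
    }
  }

AwayFromZero : (ℕ → ℚ) → Set
AwayFromZero s = ∃[ δ ] (0ℚ ℚ.< δ × ∃[ N ] (∀ n → N ℕ.≤ n → δ ℚ.≤ ℚ.∣ s n ∣))

small-or-away : ∀ x ε → 0ℚ ℚ.< ε →
  (∃[ N ] (∀ n → N ℕ.≤ n → ℚ.∣ seq x n ∣ ℚ.< ε)) ⊎ AwayFromZero (seq x)
small-or-away x ε 0<ε with cauchy x (½ ℚ.* (½ ℚ.* ε)) (half-positive (half-positive 0<ε))
... | N , close with ℚ.∣ seq x N ∣ ℚ.<? ½ ℚ.* ε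
... | yes small = inj₁ (N , λ n N≤n → begin-strict
  ℚ.∣ seq x n ∣                              ≤⟨ ∣∣-triangle (seq x n) (seq x N) ⟩
  ℚ.∣ seq x n ℚ.- seq x N ∣ ℚ.+ ℚ.∣ seq x N ∣ <⟨ ℚ.+-mono-< (close n N N≤n ℕ.≤-refl) small ⟩
  ½ ℚ.* (½ ℚ.* ε) ℚ.+ ½ ℚ.* ε                ≤⟨ ℚ.+-monoˡ-≤ (½ ℚ.* ε) quarter≤half ⟩
  ½ ℚ.* ε ℚ.+ ½ ℚ.* ε                        ≡⟨ half+half ε ⟩
  ε                                          ∎)
  where
  open ℚ.≤-Reasoning
  quarter≤half : ½ ℚ.* (½ ℚ.* ε) ℚ.≤ ½ ℚ.* ε
  quarter≤half = begin
    ½ ℚ.* (½ ℚ.* ε)                         ≡⟨ ℚ.+-identityʳ _ ⟨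
    ½ ℚ.* (½ ℚ.* ε) ℚ.+ 0ℚ                  ≤⟨ ℚ.+-monoʳ-≤ (½ ℚ.* (½ ℚ.* ε))
                                                  (ℚ.<⇒≤ (half-positive (half-positive 0<ε))) ⟩
    ½ ℚ.* (½ ℚ.* ε) ℚ.+ ½ ℚ.* (½ ℚ.* ε)     ≡⟨ half+half (½ ℚ.* ε) ⟩
    ½ ℚ.* ε                                 ∎
... | no large = inj₂ (½ ℚ.* (½ ℚ.* ε) , half-positive (half-positive 0<ε) , N ,
  λ n N≤n → ℚ.≮⇒≥ λ ∣xₙ∣<δ → large (begin-strict
    ℚ.∣ seq x N ∣                              ≤⟨ ∣∣-triangle (seq x N) (seq x n) ⟩
    ℚ.∣ seq x N ℚ.- seq x n ∣ ℚ.+ ℚ.∣ seq x n ∣ <⟨ ℚ.+-mono-< (close N n ℕ.≤-refl N≤n) ∣xₙ∣<δ ⟩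
    ½ ℚ.* (½ ℚ.* ε) ℚ.+ ½ ℚ.* (½ ℚ.* ε)        ≡⟨ half+half (½ ℚ.* ε) ⟩
    ½ ℚ.* ε                                    ∎))
  where open ℚ.≤-Reasoning

≃0⇒null : ∀ {x} → x ≃ 0ℝ → Null (seq x)
≃0⇒null {x} (wrap x≈0) = null-resp (λ n → sym (ℚ.+-identityʳ (seq x n))) x≈0

null⇒≃0 : ∀ {x} → Null (seq x) → x ≃ 0ℝ
null⇒≃0 {x} null = wrap (null-resp (λ n → ℚ.+-identityʳ (seq x n)) null)

-ᴿ≃0⇒≃ : ∀ {x y} → x -ᴿ y ≃ 0ℝ → x ≃ y
-ᴿ≃0⇒≃ {x} {y} x-y≃0 = by-combination₁ 1ℝ x-y≃0 λ n →
  solve 2 (λ x y → x :- y := con 1ℚ :* (x :+ con (ℚ.- 1ℚ) :* y :- con 0ℚ)) refl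
    (seq x n) (seq y n)

≃⇒-ᴿ≃0 : ∀ {x y} → x ≃ y → x -ᴿ y ≃ 0ℝ
≃⇒-ᴿ≃0 {x} {y} x≃y = by-combination₁ 1ℝ x≃y λ n →
  solve 2 (λ x y → x :+ con (ℚ.- 1ℚ) :* y :- con 0ℚ := con 1ℚ :* (x :- y)) refl
    (seq x n) (seq y n)

away⇒≄0 : ∀ {x} → AwayFromZero (seq x) → ¬ (x ≃ 0ℝ)
away⇒≄0 {x} (δ , 0<δ , M , away) x≃0 = meet (≃0⇒null x≃0 δ 0<δ)
  where
  meet : ¬ (∃[ N ] (∀ n → N ℕ.≤ n → ℚ.∣ seq x n ∣ ℚ.< δ))
  meet (N , small) = ℚ.<-irrefl {δ} refl
    (ℚ.≤-<-trans (away (M ℕ.⊔ N) (ℕ.m≤m⊔n M N)) (small (M ℕ.⊔ N) (ℕ.m≤n⊔m M N)))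

away-cancel : ∀ {s t} → AwayFromZero t → Null (λ n → s n ℚ.* t n) → Null s
away-cancel {s} {t} (δ , 0<δ , M , away) null ε 0<ε
  with null (δ ℚ.* ε) (ℚ.positive⁻¹ (δ ℚ.* ε)
         {{ℚ.pos*pos⇒pos δ {{ℚ.positive 0<δ}} ε {{ℚ.positive 0<ε}}}})
... | N , small = M ℕ.⊔ N , λ n ≤n →
  ℚ.*-cancelˡ-<-nonNeg δ {{ℚ.nonNegative (ℚ.<⇒≤ 0<δ)}} (begin-strict
    δ ℚ.* ℚ.∣ s n ∣             ≤⟨ ℚ.*-monoʳ-≤-nonNeg ℚ.∣ s n ∣ {{ℚ.∣-∣-nonNeg (s n)}}
                                     (away n (ℕ.m⊔n≤o⇒m≤o M N ≤n)) ⟩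
    ℚ.∣ t n ∣ ℚ.* ℚ.∣ s n ∣     ≡⟨ ℚ.*-comm ℚ.∣ t n ∣ ℚ.∣ s n ∣ ⟩
    ℚ.∣ s n ∣ ℚ.* ℚ.∣ t n ∣     ≡⟨ ℚ.∣p*q∣≡∣p∣*∣q∣ (s n) (t n) ⟨
    ℚ.∣ s n ℚ.* t n ∣           <⟨ small n (ℕ.m⊔n≤o⇒n≤o M N ≤n) ⟩
    δ ℚ.* ε                     ∎)
  where open ℚ.≤-Reasoning

≄0-cancel : ∀ {x y} → ¬ (x ≃ 0ℝ) → x *ᴿ y ≃ 0ℝ → y ≃ 0ℝ
≄0-cancel {x} {y} x≄0 xy≃0 = null⇒≃0 λ ε 0<ε →
  [ (λ small → small)
  , (λ away → contradiction (null⇒≃0 (away-cancel away (≃0⇒null xy≃0))) x≄0)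
  ]′ (small-or-away y ε 0<ε)

≃-stable : ∀ {x y} → ¬ ¬ (x ≃ y) → x ≃ y
≃-stable {x} {y} ¬¬x≃y = -ᴿ≃0⇒≃ (null⇒≃0 λ ε 0<ε →
  [ (λ small → small)
  , (λ away → contradiction (away⇒≄0 {x -ᴿ y} away ∘ ≃⇒-ᴿ≃0) ¬¬x≃y)
  ]′ (small-or-away (x -ᴿ y) ε 0<ε))

≢⇒0<∣-∣ : ∀ {a b} → a ≢ b → 0ℚ ℚ.< ℚ.∣ a ℚ.- b ∣
≢⇒0<∣-∣ {a} {b} a≢b = ℚ.≰⇒> λ ≤0 → a≢b (begin
  a                ≡⟨ solve 2 (λ a b → a := (a :- b) :+ b) refl a b ⟩
  (a ℚ.- b) ℚ.+ b  ≡⟨ cong (ℚ._+ b) (ℚ.∣p∣≡0⇒p≡0 (a ℚ.- b)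
                        (ℚ.≤-antisym ≤0 (ℚ.0≤∣p∣ (a ℚ.- b)))) ⟩
  0ℚ ℚ.+ b         ≡⟨ ℚ.+-identityˡ b ⟩
  b                ∎)
  where open ≡-Reasoning

fromℚ-injective : ∀ {a b} → fromℚ a ≃ fromℚ b → a ≡ b
fromℚ-injective {a} {b} (wrap a≈b) = decidable-stable (a ℚ.≟ b) λ a≢b →
  far (a≈b ℚ.∣ a ℚ.- b ∣ (≢⇒0<∣-∣ a≢b))
  where
  far : ¬ (∃[ N ] (∀ n → N ℕ.≤ n → ℚ.∣ a ℚ.- b ∣ ℚ.< ℚ.∣ a ℚ.- b ∣))
  far (N , small) = ℚ.<-irrefl {ℚ.∣ a ℚ.- b ∣} refl (small N ℕ.≤-refl)

/1-homo-+ : ∀ i j → (i ℤ.+ j) ℚ./ 1 ≡ i ℚ./ 1 ℚ.+ j ℚ./ 1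
/1-homo-+ i j = ℚ.toℚᵘ-injective (begin
  toℚᵘ ((i ℤ.+ j) ℚ./ 1)              ≈⟨ ℚ.toℚᵘ-fromℚᵘ (ℚᵘ.mkℚᵘ (i ℤ.+ j) 0) ⟩
  ℚᵘ.mkℚᵘ (i ℤ.+ j) 0                 ≈⟨ ℚᵘ.*≡* (cong (ℤ._* + 1)
                                           (cong₂ ℤ._+_ (ℤ.*-identityʳ i) (ℤ.*-identityʳ j))) ⟨
  ℚᵘ.mkℚᵘ i 0 ℚᵘ.+ ℚᵘ.mkℚᵘ j 0        ≈⟨ ℚᵘ.+-cong (ℚ.toℚᵘ-fromℚᵘ (ℚᵘ.mkℚᵘ i 0))
                                                    (ℚ.toℚᵘ-fromℚᵘ (ℚᵘ.mkℚᵘ j 0)) ⟨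
  toℚᵘ (i ℚ./ 1) ℚᵘ.+ toℚᵘ (j ℚ./ 1)  ≈⟨ ℚ.toℚᵘ-homo-+ (i ℚ./ 1) (j ℚ./ 1) ⟨
  toℚᵘ (i ℚ./ 1 ℚ.+ j ℚ./ 1)          ∎)
  where open ℚᵘ.≃-Reasoning

/1-homo-* : ∀ i j → (i ℤ.* j) ℚ./ 1 ≡ i ℚ./ 1 ℚ.* (j ℚ./ 1)
/1-homo-* i j = ℚ.toℚᵘ-injective (begin
  toℚᵘ ((i ℤ.* j) ℚ./ 1)              ≈⟨ ℚ.toℚᵘ-fromℚᵘ (ℚᵘ.mkℚᵘ (i ℤ.* j) 0) ⟩
  ℚᵘ.mkℚᵘ i 0 ℚᵘ.* ℚᵘ.mkℚᵘ j 0        ≈⟨ ℚᵘ.*-cong (ℚ.toℚᵘ-fromℚᵘ (ℚᵘ.mkℚᵘ i 0))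
                                                    (ℚ.toℚᵘ-fromℚᵘ (ℚᵘ.mkℚᵘ j 0)) ⟨
  toℚᵘ (i ℚ./ 1) ℚᵘ.* toℚᵘ (j ℚ./ 1)  ≈⟨ ℚ.toℚᵘ-homo-* (i ℚ./ 1) (j ℚ./ 1) ⟨
  toℚᵘ (i ℚ./ 1 ℚ.* (j ℚ./ 1))        ∎)
  where open ℚᵘ.≃-Reasoning

/1-injective : ∀ {i j} → i ℚ./ 1 ≡ j ℚ./ 1 → i ≡ j
/1-injective {i} {j} eq with ℚ./-injective-≃ (ℚᵘ.mkℚᵘ i 0) (ℚᵘ.mkℚᵘ j 0) eq
... | ℚᵘ.*≡* i*1≡j*1 = ℤ.*-cancelʳ-≡ i j (+ 1) i*1≡j*1

fromℤ-injective : ∀ {i j} → fromℤ i ≃ fromℤ j → i ≡ j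
fromℤ-injective = /1-injective ∘ fromℚ-injective

fromℤ-homo-+ : ∀ i j → fromℤ (i ℤ.+ j) ≃ fromℤ i +ᴿ fromℤ j
fromℤ-homo-+ i j = pointwise λ _ → /1-homo-+ i j

rational-cotransitive : ∀ {a b} → a ≢ b → ∀ x → ¬ (x ≃ fromℚ a) ⊎ ¬ (x ≃ fromℚ b)
rational-cotransitive {a} {b} a≢b x =
  [ inj₂ ∘ near-a⇒≄b , inj₁ ∘ (λ away → away⇒≄0 {x -ᴿ fromℚ a} away ∘ ≃⇒-ᴿ≃0) ]′
    (small-or-away (x -ᴿ fromℚ a) h 0<h)
  where
  h : ℚ
  h = ½ ℚ.* ℚ.∣ a ℚ.- b ∣
  0<h : 0ℚ ℚ.< h
  0<h = half-positive (≢⇒0<∣-∣ a≢b)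
  identity : ∀ n → seq (x -ᴿ fromℚ a) n ≡ seq x n ℚ.- a
  identity n = solve 2 (λ x a → x :+ con (ℚ.- 1ℚ) :* a := x :- a) refl (seq x n) a
  open ℚ.≤-Reasoning
  near-a⇒≄b : ∃[ M ] (∀ n → M ℕ.≤ n → ℚ.∣ seq (x -ᴿ fromℚ a) n ∣ ℚ.< h) → ¬ (x ≃ fromℚ b)
  near-a⇒≄b (M , near-a) (wrap x≈b) = meet (x≈b h 0<h)
    where
    meet : ¬ (∃[ N ] (∀ n → N ℕ.≤ n → ℚ.∣ seq x n ℚ.- b ∣ ℚ.< h))
    meet (N , near-b) = ℚ.<-irrefl {ℚ.∣ a ℚ.- b ∣} refl (begin-strict
      ℚ.∣ a ℚ.- b ∣
        ≤⟨ ∣-∣-triangle a (seq x n) b ⟩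
      ℚ.∣ a ℚ.- seq x n ∣ ℚ.+ ℚ.∣ seq x n ℚ.- b ∣
        ≡⟨ cong (ℚ._+ ℚ.∣ seq x n ℚ.- b ∣)
             (trans (∣-∣-comm a (seq x n)) (cong ℚ.∣_∣ (sym (identity n)))) ⟩
      ℚ.∣ seq (x -ᴿ fromℚ a) n ∣ ℚ.+ ℚ.∣ seq x n ℚ.- b ∣
        <⟨ ℚ.+-mono-< (near-a n (ℕ.m≤m⊔n M N)) (near-b n (ℕ.m≤n⊔m M N)) ⟩
      h ℚ.+ h
        ≡⟨ half+half ℚ.∣ a ℚ.- b ∣ ⟩
      ℚ.∣ a ℚ.- b ∣ ∎)
      where
      n : ℕ
      n = M ℕ.⊔ N

extend : ∀ {k} {P : Fin k → Set} i → P i → (∀ j → j ≢ i → P j) → ∀ j → P j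
extend i Pi others j with j ≟ᶠ i
... | yes refl = Pi
... | no j≢i = others j j≢i

all-but-one : ∀ {k} (a : Fin (suc k) → ℚ) → Injective _≡_ _≡_ a → ∀ x →
  ∃[ i ] (∀ j → j ≢ i → ¬ (x ≃ fromℚ (a j)))
all-but-one {zero} a a-inj x = zero , λ { zero 0≢0 → contradiction refl 0≢0 }
all-but-one {suc k} a a-inj x = step (all-but-one (a ∘ suc) (suc-injective ∘ a-inj) x)
  where
  step : ∃[ i ] (∀ j → j ≢ i → ¬ (x ≃ fromℚ (a (suc j)))) →
    ∃[ i ] (∀ j → j ≢ i → ¬ (x ≃ fromℚ (a j)))
  step (i , others) = [ not-first , not-i ]′
    (rational-cotransitive ((λ ()) ∘ a-inj {zero} {suc i}) x)
    where
    not-first : ¬ (x ≃ fromℚ (a zero)) → ∃[ i ] (∀ j → j ≢ i → ¬ (x ≃ fromℚ (a j)))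
    not-first x≄a₀ = suc i , λ { zero _ → x≄a₀ ; (suc j) j≢i → others j (j≢i ∘ cong suc) }
    not-i : ¬ (x ≃ fromℚ (a (suc i))) → ∃[ i ] (∀ j → j ≢ i → ¬ (x ≃ fromℚ (a j)))
    not-i x≄aᵢ = zero , λ { zero 0≢0 → contradiction refl 0≢0
                          ; (suc j) _ → extend i x≄aᵢ others j }

-- x differs from all of the rational candidates but one, and equality to that one is
-- stable: so the candidate equal to x can be named.
locate : ∀ {k} (a : Fin (suc k) → ℚ) → Injective _≡_ _≡_ a → ∀ x →
  ¬ (∀ i → ¬ (x ≃ fromℚ (a i))) → ∃[ i ] (x ≃ fromℚ (a i))
locate a a-inj x some = map₂
  (λ {i} others → ≃-stable λ x≄aᵢ → some (extend i x≄aᵢ others))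
  (all-but-one a a-inj x)

-- Sums

open CommutativeRing ℝ-commutativeRing using (semiring; setoid)
open import Algebra.Properties.Semiring.Sum semiring
  using (sum-cong-≋; ∑-distrib-+; ∑-permute; *-distribˡ-sum)

module ≃-Reasoning = SetoidReasoning setoid

δ : ∀ {n} → Fin n → Fin n → ℝ
δ i j = if does (i ≟ᶠ j) then 1ℝ else 0ℝ

∑-0 : ∀ {n} (f : Vector ℝ n) → (∀ i → f i ≃ 0ℝ) → ∑ f ≃ 0ℝ
∑-0 {zero} f f≃0 = ≃-refl
∑-0 {suc n} f f≃0 = by-combination₂ 1ℝ 1ℝ (f≃0 zero) (∑-0 (f ∘ suc) (f≃0 ∘ suc)) λ n →
  solve 2 (λ a b → a :+ b :- con 0ℚ := con 1ℚ :* (a :- con 0ℚ) :+ con 1ℚ :* (b :- con 0ℚ)) refl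
    (seq (f zero) n) (seq (∑ (f ∘ suc)) n)

∑-const : ∀ n x → ∑ {n} (λ _ → x) ≃ fromℤ (+ n) *ᴿ x
∑-const zero x = pointwise λ n → sym (ℚ.*-zeroˡ (seq x n))
∑-const (suc n) x = by-combination₂ 1ℝ (-1ℝ *ᴿ x) (∑-const n x) (fromℤ-homo-+ (+ 1) (+ n)) λ i →
  solve 4 (λ x s t u → x :+ s :- u :* x :=
      con 1ℚ :* (s :- t :* x) :+ con (ℚ.- 1ℚ) :* x :* (u :- (con 1ℚ :+ t))) refl
    (seq x i) (seq (∑ {n} (λ _ → x)) i) (+ n ℚ./ 1) (+ suc n ℚ./ 1)

∑-δ : ∀ {n} (f : Vector ℝ n) k → ∑ (λ j → f j *ᴿ δ j k) ≃ f k
∑-δ {suc n} f zero = by-combination₁ 1ℝ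
  (∑-0 (λ j → f (suc j) *ᴿ 0ℝ) λ j → pointwise λ n → ℚ.*-zeroʳ (seq (f (suc j)) n)) λ n →
  solve 2 (λ a s → a :* con 1ℚ :+ s :- a := con 1ℚ :* (s :- con 0ℚ)) refl
    (seq (f zero) n) (seq (∑ λ j → f (suc j) *ᴿ 0ℝ) n)
∑-δ {suc n} f (suc k) = by-combination₁ 1ℝ (∑-δ (f ∘ suc) k) λ n →
  solve 3 (λ a s b → a :* con 0ℚ :+ s :- b := con 1ℚ :* (s :- b)) refl
    (seq (f zero) n) (seq (∑ λ j → f (suc j) *ᴿ δ j k) n) (seq (f (suc k)) n)

δ-sym : ∀ {n} (i j : Fin n) → δ i j ≡ δ j i
δ-sym zero zero = refl
δ-sym zero (suc j) = refl
δ-sym (suc i) zero = refl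
δ-sym (suc i) (suc j) = δ-sym i j

∑-splitAt : ∀ m {n} (f : Vector ℝ (m ℕ.+ n)) →
  ∑ f ≃ ∑ (f ∘ (_↑ˡ n)) +ᴿ ∑ (f ∘ (m ↑ʳ_))
∑-splitAt zero f = pointwise λ n → sym (ℚ.+-identityˡ _)
∑-splitAt (suc m) {n} f = by-combination₁ 1ℝ (∑-splitAt m (f ∘ suc)) λ i →
  solve 4 (λ a s t u → a :+ s :- (a :+ t :+ u) := con 1ℚ :* (s :- (t :+ u))) refl
    (seq (f zero) i) (seq (∑ (f ∘ suc)) i) (seq (∑ (f ∘ suc ∘ (_↑ˡ n))) i)
    (seq (∑ (f ∘ suc ∘ (m ↑ʳ_))) i)

∑-combine : ∀ m {n} (f : Vector ℝ (m * n)) → ∑ f ≃ ∑ λ i → ∑ λ j → f (combine {m} i j)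
∑-combine zero f = ≃-refl
∑-combine (suc m) {n} f = ≃-trans (∑-splitAt n f) (+ᴿ-cong ≃-refl (∑-combine m (f ∘ (n ↑ʳ_))))

∑-reindex : ∀ {l m n} (π : Fin l ↔ (Fin m × Fin n)) (f : Vector ℝ l) →
  ∑ f ≃ ∑ λ i → ∑ λ j → f (Inverse.from π (i , j))
∑-reindex {m = m} π f = ≃-trans (∑-permute f (↔-sym π ↔-∘ *↔×)) (≃-trans
  (∑-combine m (λ i → f (Inverse.from π (Inverse.to *↔× i))))
  (sum-cong-≋ λ i → sum-cong-≋ λ j →
    ≡⇒≃ (cong (f ∘ Inverse.from π) (Inverse.strictlyInverseˡ *↔× (i , j)))))
  where
  ≡⇒≃ : ∀ {x y} → x ≡ y → x ≃ y
  ≡⇒≃ refl = ≃-refl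

-- Eigenspaces of the all-ones matrix

OnesEigenvector : ∀ {m} → ℝ → Vector ℝ m → Set
OnesEigenvector t z = ∀ k → t *ᴿ z k ≃ ∑ z

ones-eigenvector-zero : ∀ {m t} {z : Vector ℝ m} → OnesEigenvector t z →
  ¬ (t ≃ fromℤ (+ m)) → ¬ (t ≃ 0ℝ) → ∀ k → z k ≃ 0ℝ
ones-eigenvector-zero {m} {t} {z} eigen t≄m t≄0 k = ≄0-cancel t≄0 (≃-trans (eigen k) Z≃0)
  where
  tZ≃mZ : t *ᴿ ∑ z ≃ fromℤ (+ m) *ᴿ ∑ z
  tZ≃mZ = ≃-trans (*-distribˡ-sum t z) (≃-trans (sum-cong-≋ eigen) (∑-const m (∑ z)))
  Z≃0 : ∑ z ≃ 0ℝ
  Z≃0 = ≄0-cancel {t -ᴿ fromℤ (+ m)} (t≄m ∘ -ᴿ≃0⇒≃)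
    (by-combination₁ 1ℝ tZ≃mZ λ n →
      solve 3 (λ t m Z → (t :+ con (ℚ.- 1ℚ) :* m) :* Z :- con 0ℚ :=
                         con 1ℚ :* (t :* Z :- m :* Z)) refl
        (seq t n) (+ m ℚ./ 1) (seq (∑ z) n))

ones-dimension-m : ∀ m → HasDimension (OnesEigenvector {suc m} (fromℤ (+ suc m))) 1
ones-dimension-m m = (λ _ _ → 1ℝ) , record
  { member = λ _ _ → ≃-sym (∑-const (suc m) 1ℝ)
  ; independent = λ { c c≈0 zero → unwrap (coefficient-zero (c zero) (wrap (c≈0 zero))) }
  ; spanning = λ z eigen → (λ _ → z zero) , λ k → unwrap (constant z eigen k)
  }
  where
  coefficient-zero : ∀ c → c *ᴿ 1ℝ +ᴿ 0ℝ ≃ 0ℝ → c ≃ 0ℝ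
  coefficient-zero c c1+0≃0 = by-combination₁ 1ℝ c1+0≃0 λ n →
    solve 1 (λ c → c :- con 0ℚ := con 1ℚ :* (c :* con 1ℚ :+ con 0ℚ :- con 0ℚ)) refl (seq c n)
  constant : ∀ z → OnesEigenvector (fromℤ (+ suc m)) z → ∀ k → z k ≃ z zero *ᴿ 1ℝ +ᴿ 0ℝ
  constant z eigen k = -ᴿ≃0⇒≃ (≄0-cancel {fromℤ (+ suc m)} (suc≢0 ∘ fromℤ-injective)
    (by-combination₂ 1ℝ -1ℝ (eigen k) (eigen zero) λ n →
      solve 4 (λ m a b Z → m :* (a :+ con (ℚ.- 1ℚ) :* (b :* con 1ℚ :+ con 0ℚ)) :- con 0ℚ :=
                 con 1ℚ :* (m :* a :- Z) :+ con (ℚ.- 1ℚ) :* (m :* b :- Z)) refl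
        (+ suc m ℚ./ 1) (seq (z k) n) (seq (z zero) n) (seq (∑ z) n)))
    where
    suc≢0 : + suc m ≢ + 0
    suc≢0 ()

ones-dimension-0 : ∀ m → HasDimension (OnesEigenvector {suc m} 0ℝ) m
ones-dimension-0 m = b , record
  { member = λ j k → by-combination₁ -1ℝ (∑-bⱼ j) λ n →
      solve 2 (λ x s → con 0ℚ :* x :- s := con (ℚ.- 1ℚ) :* (s :- con 0ℚ)) refl
        (seq (b j k) n) (seq (∑ (b j)) n)
  ; independent = λ c c≈0 k → unwrap {c k} {0ℝ}
      (≃-trans (≃-sym (∑-δ c k)) (wrap (c≈0 (suc k))))
  ; spanning = λ z eigen → z ∘ suc , λ k → unwrap (expand z eigen k)
  }
  where
  b : Fin m → Vector ℝ (suc m)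
  b j zero = -1ℝ
  b j (suc k) = δ j k
  ∑-bⱼ : ∀ j → ∑ (b j) ≃ 0ℝ
  ∑-bⱼ j = by-combination₁ 1ℝ (≃-trans (sum-cong-≋ δ-flip) (∑-δ (λ _ → 1ℝ) j)) λ n →
    solve 1 (λ s → con (ℚ.- 1ℚ) :+ s :- con 0ℚ := con 1ℚ :* (s :- con 1ℚ)) refl
      (seq (∑ (δ j)) n)
    where
    δ-flip : ∀ k → δ j k ≃ 1ℝ *ᴿ δ k j
    δ-flip k = pointwise λ n →
      trans (cong (λ x → seq x n) (δ-sym j k)) (sym (ℚ.*-identityˡ (seq (δ k j) n)))
  expand : ∀ z → OnesEigenvector 0ℝ z → ∀ k → z k ≃ linComb (z ∘ suc) b k
  expand z eigen (suc k) = ≃-sym (∑-δ (z ∘ suc) k)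
  expand z eigen zero = ≃-trans z₀≃ (≃-trans (*-distribˡ-sum -1ℝ (z ∘ suc))
    (sum-cong-≋ λ j → pointwise λ n → ℚ.*-comm (ℚ.- 1ℚ) (seq (z (suc j)) n)))
    where
    z₀≃ : z zero ≃ -1ℝ *ᴿ ∑ (z ∘ suc)
    z₀≃ = by-combination₁ -1ℝ (eigen zero) λ n →
      solve 2 (λ a s → a :- con (ℚ.- 1ℚ) :* s := con (ℚ.- 1ℚ) :* (con 0ℚ :* a :- (a :+ s))) refl
        (seq (z zero) n) (seq (∑ (z ∘ suc)) n)

-- The spectrum of the 2 × m rook's graph

-2ℝ : ℝ
-2ℝ = fromℤ -[1+ 1 ]

rookEntry : ∀ {r m} → Fin r × Fin m → Fin r × Fin m → ℝ
rookEntry (a , k) (b , l) = δ a b +ᴿ δ k l +ᴿ -2ℝ *ᴿ (δ a b *ᴿ δ k l)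

∑-rook-row : ∀ {m} α (w : Vector ℝ m) k →
  ∑ (λ l → (α +ᴿ δ k l +ᴿ -2ℝ *ᴿ (α *ᴿ δ k l)) *ᴿ w l) ≃
    α *ᴿ ∑ w +ᴿ (1ℝ +ᴿ -2ℝ *ᴿ α) *ᴿ w k
∑-rook-row α w k = begin
  ∑ (λ l → (α +ᴿ δ k l +ᴿ -2ℝ *ᴿ (α *ᴿ δ k l)) *ᴿ w l)
    ≈⟨ sum-cong-≋ rearrange ⟩
  ∑ (λ l → α *ᴿ w l +ᴿ β *ᴿ (w l *ᴿ δ l k))
    ≈⟨ ∑-distrib-+ (λ l → α *ᴿ w l) (λ l → β *ᴿ (w l *ᴿ δ l k)) ⟩
  ∑ (λ l → α *ᴿ w l) +ᴿ ∑ (λ l → β *ᴿ (w l *ᴿ δ l k))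
    ≈⟨ +ᴿ-cong (*-distribˡ-sum α w) (*-distribˡ-sum β (λ l → w l *ᴿ δ l k)) ⟨
  α *ᴿ ∑ w +ᴿ β *ᴿ ∑ (λ l → w l *ᴿ δ l k)
    ≈⟨ +ᴿ-cong ≃-refl (*ᴿ-cong ≃-refl (∑-δ w k)) ⟩
  α *ᴿ ∑ w +ᴿ β *ᴿ w k ∎
  where
  open ≃-Reasoning
  β : ℝ
  β = 1ℝ +ᴿ -2ℝ *ᴿ α
  rearrange : ∀ l → (α +ᴿ δ k l +ᴿ -2ℝ *ᴿ (α *ᴿ δ k l)) *ᴿ w l ≃
    α *ᴿ w l +ᴿ β *ᴿ (w l *ᴿ δ l k)
  rearrange l = pointwise λ n → trans
    (solve 3 (λ α d w → (α :+ d :+ con (-[1+ 1 ] ℚ./ 1) :* (α :* d)) :* w :=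
        α :* w :+ (con 1ℚ :+ con (-[1+ 1 ] ℚ./ 1) :* α) :* (w :* d)) refl
      (seq α n) (seq (δ k l) n) (seq (w l) n))
    (cong (λ d → seq (α *ᴿ w l +ᴿ β *ᴿ (w l *ᴿ d)) n) (δ-sym k l))

record RookMatrix {n} (A : Matrix n) (m : ℕ) : Set where
  field
    cells : Fin n ↔ (Fin 2 × Fin m)
    entry : ∀ e f → A e f ≃ rookEntry (Inverse.to cells e) (Inverse.to cells f)

  cell : Fin n → Fin 2 × Fin m
  cell = Inverse.to cells

  at : Fin 2 → Fin m → Fin n
  at a k = Inverse.from cells (a , k)

  cell-at : ∀ a k → cell (at a k) ≡ (a , k)
  cell-at a k = Inverse.strictlyInverseˡ cells (a , k)

  at-cell : (P : Fin n → Set) → (∀ a k → P (at a k)) → ∀ e → P e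
  at-cell P p e = subst P (Inverse.strictlyInverseʳ cells e) (p (proj₁ (cell e)) (proj₂ (cell e)))

other : Fin 2 → Fin 2
other zero = suc zero
other (suc zero) = zero

module _ {n m} {A : Matrix n} (R : RookMatrix A m) where
  open RookMatrix R

  rook-action : ∀ v a k →
    (A ·ᴹ v) (at a k) ≃ ∑ (λ l → v (at a l)) -ᴿ v (at a k) +ᴿ v (at (other a) k)
  rook-action v a k = begin
    ∑ (λ f → A (at a k) f *ᴿ v f)
      ≈⟨ ∑-reindex cells (λ f → A (at a k) f *ᴿ v f) ⟩
    ∑ (λ b → ∑ λ l → A (at a k) (at b l) *ᴿ v (at b l))
      ≈⟨ sum-cong-≋ (λ b → sum-cong-≋ λ l → *ᴿ-cong {u = v (at b l)} (entry-at b l) ≃-refl) ⟩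
    ∑ (λ b → ∑ λ l → rookEntry (a , k) (b , l) *ᴿ v (at b l))
      ≈⟨ sum-cong-≋ (λ b → ∑-rook-row (δ a b) (λ l → v (at b l)) k) ⟩
    ∑ (λ b → δ a b *ᴿ ∑ (λ l → v (at b l)) +ᴿ (1ℝ +ᴿ -2ℝ *ᴿ δ a b) *ᴿ v (at b k))
      ≈⟨ two-rows a ⟩
    ∑ (λ l → v (at a l)) -ᴿ v (at a k) +ᴿ v (at (other a) k) ∎
    where
    open ≃-Reasoning
    entry-at : ∀ b l → A (at a k) (at b l) ≃ rookEntry (a , k) (b , l)
    entry-at b l = subst (A (at a k) (at b l) ≃_) (cong₂ rookEntry (cell-at a k) (cell-at b l))
      (entry (at a k) (at b l))
    two-rows : ∀ a →
      ∑ (λ b → δ a b *ᴿ ∑ (λ l → v (at b l)) +ᴿ (1ℝ +ᴿ -2ℝ *ᴿ δ a b) *ᴿ v (at b k)) ≃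
        ∑ (λ l → v (at a l)) -ᴿ v (at a k) +ᴿ v (at (other a) k)
    two-rows zero = pointwise λ i → solve 4 (λ X Y x y →
        con 1ℚ :* X :+ (con 1ℚ :+ con (-[1+ 1 ] ℚ./ 1) :* con 1ℚ) :* x :+
          (con 0ℚ :* Y :+ (con 1ℚ :+ con (-[1+ 1 ] ℚ./ 1) :* con 0ℚ) :* y :+ con 0ℚ) :=
        X :+ con (ℚ.- 1ℚ) :* x :+ y) refl
      (seq (∑ λ l → v (at zero l)) i) (seq (∑ λ l → v (at (suc zero) l)) i)
      (seq (v (at zero k)) i) (seq (v (at (suc zero) k)) i)
    two-rows (suc zero) = pointwise λ i → solve 4 (λ X Y x y →
        con 0ℚ :* X :+ (con 1ℚ :+ con (-[1+ 1 ] ℚ./ 1) :* con 0ℚ) :* x :+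
          (con 1ℚ :* Y :+ (con 1ℚ :+ con (-[1+ 1 ] ℚ./ 1) :* con 1ℚ) :* y :+ con 0ℚ) :=
        Y :+ con (ℚ.- 1ℚ) :* y :+ x) refl
      (seq (∑ λ l → v (at zero l)) i) (seq (∑ λ l → v (at (suc zero) l)) i)
      (seq (v (at zero k)) i) (seq (v (at (suc zero) k)) i)

  eigen-row : ∀ {μ v} → Eigenspace A μ v → ∀ a k →
    ∑ (λ l → v (at a l)) -ᴿ v (at a k) +ᴿ v (at (other a) k) ≃ μ *ᴿ v (at a k)
  eigen-row {μ} {v} eigen a k =
    ≃-trans (≃-sym (rook-action v a k)) (wrap {y = μ *ᴿ v (at a k)} (eigen (at a k)))

  fold-eigenvector : ∀ {μ v s} → s *ᴿ s ≃ 1ℝ → Eigenspace A μ v →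
    OnesEigenvector (μ +ᴿ 1ℝ -ᴿ s) (λ k → v (at zero k) +ᴿ s *ᴿ v (at (suc zero) k))
  fold-eigenvector {μ} {v} {s} ss≃1 eigen k = ≃-trans
    (by-combination₃ {f = X +ᴿ s *ᴿ Y} -1ℝ (-1ℝ *ᴿ s) (-1ℝ *ᴿ y k)
      (eigen-row {μ} {v} eigen zero k) (eigen-row {μ} {v} eigen (suc zero) k) ss≃1 λ n →
      solve 6 (λ μ s x y X Y →
        (μ :+ con 1ℚ :+ con (ℚ.- 1ℚ) :* s) :* (x :+ s :* y) :- (X :+ s :* Y) :=
        con (ℚ.- 1ℚ) :* (X :+ con (ℚ.- 1ℚ) :* x :+ y :- μ :* x) :+
        con (ℚ.- 1ℚ) :* s :* (Y :+ con (ℚ.- 1ℚ) :* y :+ x :- μ :* y) :+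
        con (ℚ.- 1ℚ) :* y :* (s :* s :- con 1ℚ)) refl
      (seq μ n) (seq s n) (seq (x k) n) (seq (y k) n) (seq X n) (seq Y n))
    (≃-sym (≃-trans (∑-distrib-+ x (λ l → s *ᴿ y l)) (+ᴿ-cong ≃-refl (≃-sym (*-distribˡ-sum s y)))))
    where
    x y : Vector ℝ m
    x l = v (at zero l)
    y l = v (at (suc zero) l)
    X Y : ℝ
    X = ∑ x
    Y = ∑ y

  sign : ℝ → Fin 2 → ℝ
  sign s zero = 1ℝ
  sign s (suc zero) = s

  unfold : ℝ → Vector ℝ m → Vector ℝ n
  unfold s z e = sign s (proj₁ (cell e)) *ᴿ z (proj₂ (cell e))

  unfold-at : ∀ s z a k → unfold s z (at a k) ≃ sign s a *ᴿ z k
  unfold-at s z a k = subst (unfold s z (at a k) ≃_)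
    (cong (λ (b , l) → sign s b *ᴿ z l) (cell-at a k)) ≃-refl

  unfold-eigenvector : ∀ {μ s t z} → s *ᴿ s ≃ 1ℝ → μ +ᴿ 1ℝ ≃ t +ᴿ s →
    OnesEigenvector t z → Eigenspace A μ (unfold s z)
  unfold-eigenvector {μ} {s} {t} {z} ss≃1 μ+1≃t+s eigen =
    at-cell (λ e → (A ·ᴹ unfold s z) e ≈ᴿ μ *ᴿ unfold s z e) λ a k → unwrap (begin
      (A ·ᴹ unfold s z) (at a k)
        ≈⟨ rook-action (unfold s z) a k ⟩
      ∑ (λ l → unfold s z (at a l)) -ᴿ unfold s z (at a k) +ᴿ unfold s z (at (other a) k)
        ≈⟨ +ᴿ-cong (+ᴿ-cong (sum-cong-≋ (unfold-at s z a)) (*ᴿ-cong ≃-refl (unfold-at s z a k)))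
                  (unfold-at s z (other a) k) ⟩
      ∑ (λ l → sign s a *ᴿ z l) -ᴿ sign s a *ᴿ z k +ᴿ sign s (other a) *ᴿ z k
        ≈⟨ +ᴿ-cong (+ᴿ-cong (*-distribˡ-sum (sign s a) z) ≃-refl) ≃-refl ⟨
      sign s a *ᴿ ∑ z -ᴿ sign s a *ᴿ z k +ᴿ sign s (other a) *ᴿ z k
        ≈⟨ eigen-sign a k ⟩
      μ *ᴿ (sign s a *ᴿ z k)
        ≈⟨ *ᴿ-cong ≃-refl (unfold-at s z a k) ⟨
      μ *ᴿ unfold s z (at a k) ∎)
    where
    open ≃-Reasoning
    eigen-sign : ∀ a k → sign s a *ᴿ ∑ z -ᴿ sign s a *ᴿ z k +ᴿ sign s (other a) *ᴿ z k ≃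
      μ *ᴿ (sign s a *ᴿ z k)
    eigen-sign zero k = by-combination₂ -1ℝ (-1ℝ *ᴿ z k) (eigen k) μ+1≃t+s λ n →
      solve 5 (λ μ s t z Z →
        con 1ℚ :* Z :+ con (ℚ.- 1ℚ) :* (con 1ℚ :* z) :+ s :* z :- μ :* (con 1ℚ :* z) :=
        con (ℚ.- 1ℚ) :* (t :* z :- Z) :+
        con (ℚ.- 1ℚ) :* z :* (μ :+ con 1ℚ :- (t :+ s))) refl
      (seq μ n) (seq s n) (seq t n) (seq (z k) n) (seq (∑ z) n)
    eigen-sign (suc zero) k =
      by-combination₃ (-1ℝ *ᴿ s) (-1ℝ *ᴿ (s *ᴿ z k)) (-1ℝ *ᴿ z k) (eigen k) μ+1≃t+s ss≃1 λ n →
      solve 5 (λ μ s t z Z →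
        s :* Z :+ con (ℚ.- 1ℚ) :* (s :* z) :+ con 1ℚ :* z :- μ :* (s :* z) :=
        con (ℚ.- 1ℚ) :* s :* (t :* z :- Z) :+
        con (ℚ.- 1ℚ) :* (s :* z) :* (μ :+ con 1ℚ :- (t :+ s)) :+
        con (ℚ.- 1ℚ) :* z :* (s :* s :- con 1ℚ)) refl
      (seq μ n) (seq s n) (seq t n) (seq (z k) n) (seq (∑ z) n)

  fold-zero : ∀ {μ v s} → s *ᴿ s ≃ 1ℝ → Eigenspace A μ v →
    ¬ (μ +ᴿ 1ℝ -ᴿ s ≃ fromℤ (+ m)) → ¬ (μ +ᴿ 1ℝ -ᴿ s ≃ 0ℝ) →
    ∀ k → v (at zero k) +ᴿ s *ᴿ v (at (suc zero) k) ≃ 0ℝ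
  fold-zero {μ} {v} ss≃1 eigen = ones-eigenvector-zero (fold-eigenvector {μ} {v} ss≃1 eigen)

  unfold-dimension : ∀ {d} μ s t → s ℤ.* s ≡ + 1 → μ ℤ.+ + 1 ≡ t ℤ.+ s →
    t ℤ.+ s ℤ.+ s ≢ + m → t ℤ.+ s ℤ.+ s ≢ + 0 →
    HasDimension (OnesEigenvector {m} (fromℤ t)) d → HasDimension (Eigenspace A (fromℤ μ)) d
  unfold-dimension μ s t ss≡1 μ+1≡t+s ≢m ≢0 (b , basis) = unfold sᴿ ∘ b , record
    { member = λ j → unfold-eigenvector {μᴿ} {sᴿ} {tᴿ} ss≃1 μ+1≃t+s (member j)
    ; independent = λ c c≈0 → independent c λ k → unwrap (row-zero c k (wrap (c≈0 (at zero k))))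
    ; spanning = λ v eigen → map₂ (expand v eigen) (spanning _ (first-row-eigenvector v eigen))
    }
    where
    open IsBasis basis
    μᴿ sᴿ tᴿ : ℝ
    μᴿ = fromℤ μ
    sᴿ = fromℤ s
    tᴿ = fromℤ t
    ss≃1 : sᴿ *ᴿ sᴿ ≃ 1ℝ
    ss≃1 = pointwise λ _ → trans (sym (/1-homo-* s s)) (cong (ℚ._/ 1) ss≡1)
    -s-s≃1 : (-1ℝ *ᴿ sᴿ) *ᴿ (-1ℝ *ᴿ sᴿ) ≃ 1ℝ
    -s-s≃1 = by-combination₁ 1ℝ ss≃1 λ _ →
      solve 1 (λ s → con (ℚ.- 1ℚ) :* s :* (con (ℚ.- 1ℚ) :* s) :- con 1ℚ :=
                     con 1ℚ :* (s :* s :- con 1ℚ)) refl (s ℚ./ 1)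
    μ+1≃t+s : μᴿ +ᴿ 1ℝ ≃ tᴿ +ᴿ sᴿ
    μ+1≃t+s = pointwise λ _ →
      trans (sym (/1-homo-+ μ (+ 1))) (trans (cong (ℚ._/ 1) μ+1≡t+s) (/1-homo-+ t s))
    opposite : fromℤ (t ℤ.+ s ℤ.+ s) ≃ μᴿ +ᴿ 1ℝ -ᴿ -1ℝ *ᴿ sᴿ
    opposite = ≃-trans (fromℤ-homo-+ (t ℤ.+ s) s) (≃-trans (+ᴿ-cong (fromℤ-homo-+ t s) ≃-refl)
      (by-combination₁ -1ℝ μ+1≃t+s λ _ →
        solve 3 (λ μ s t → t :+ s :+ s :- (μ :+ con 1ℚ :+ con (ℚ.- 1ℚ) :* (con (ℚ.- 1ℚ) :* s)) :=
          con (ℚ.- 1ℚ) :* (μ :+ con 1ℚ :- (t :+ s))) refl (μ ℚ./ 1) (s ℚ./ 1) (t ℚ./ 1)))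
    second-row : ∀ v → Eigenspace A μᴿ v → ∀ k → v (at (suc zero) k) ≃ sᴿ *ᴿ v (at zero k)
    second-row v eigen k = by-combination₂ (-1ℝ *ᴿ sᴿ) (-1ℝ *ᴿ y) opposite-fold ss≃1 λ n →
      solve 3 (λ s x y → y :- s :* x :=
        con (ℚ.- 1ℚ) :* s :* (x :+ con (ℚ.- 1ℚ) :* s :* y :- con 0ℚ) :+
        con (ℚ.- 1ℚ) :* y :* (s :* s :- con 1ℚ)) refl (s ℚ./ 1) (seq x n) (seq y n)
      where
      x y : ℝ
      x = v (at zero k)
      y = v (at (suc zero) k)
      opposite-fold : x +ᴿ (-1ℝ *ᴿ sᴿ) *ᴿ y ≃ 0ℝ
      opposite-fold = fold-zero {μᴿ} {v} -s-s≃1 eigen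
        (λ eq → ≢m (fromℤ-injective (≃-trans opposite eq)))
        (λ eq → ≢0 (fromℤ-injective (≃-trans opposite eq))) k
    first-row-eigenvector : ∀ v → Eigenspace A μᴿ v →
      OnesEigenvector tᴿ (λ k → v (at zero k))
    first-row-eigenvector v eigen k =
      by-combination₃ -1ℝ 1ℝ (-1ℝ *ᴿ x) (eigen-row {μᴿ} {v} eigen zero k)
        (second-row v eigen k) μ+1≃t+s λ n →
      solve 6 (λ μ s t x y X → t :* x :- X :=
        con (ℚ.- 1ℚ) :* (X :+ con (ℚ.- 1ℚ) :* x :+ y :- μ :* x) :+
        con 1ℚ :* (y :- s :* x) :+
        con (ℚ.- 1ℚ) :* x :* (μ :+ con 1ℚ :- (t :+ s))) refl
        (μ ℚ./ 1) (s ℚ./ 1) (t ℚ./ 1) (seq x n) (seq (v (at (suc zero) k)) n)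
        (seq (∑ λ l → v (at zero l)) n)
      where
      x : ℝ
      x = v (at zero k)
    linComb-at : ∀ c a k → linComb c (unfold sᴿ ∘ b) (at a k) ≃ sign sᴿ a *ᴿ linComb c b k
    linComb-at c a k = ≃-sym (≃-trans (*-distribˡ-sum (sign sᴿ a) (λ j → c j *ᴿ b j k))
      (sum-cong-≋ λ j → ≃-trans (swap (sign sᴿ a) (c j) (b j k))
        (*ᴿ-cong {c j} ≃-refl (≃-sym (unfold-at sᴿ (b j) a k)))))
      where
      swap : ∀ x y z → x *ᴿ (y *ᴿ z) ≃ y *ᴿ (x *ᴿ z)
      swap x y z = pointwise λ n → solve 3 (λ x y z → x :* (y :* z) := y :* (x :* z)) refl
        (seq x n) (seq y n) (seq z n)
    1*-cancel : ∀ x → 1ℝ *ᴿ x ≃ x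
    1*-cancel x = pointwise λ n → ℚ.*-identityˡ (seq x n)
    row-zero : ∀ c k → linComb c (unfold sᴿ ∘ b) (at zero k) ≃ 0ℝ → linComb c b k ≃ 0ℝ
    row-zero c k =
      ≃-trans (≃-trans (≃-sym (1*-cancel (linComb c b k))) (≃-sym (linComb-at c zero k)))
    expand : ∀ v → Eigenspace A μᴿ v → ∀ {c} → (λ k → v (at zero k)) ≈ᵛ linComb c b →
      v ≈ᵛ linComb c (unfold sᴿ ∘ b)
    expand v eigen {c} v≈ = at-cell (λ e → v e ≈ᴿ linComb c (unfold sᴿ ∘ b) e) λ a k →
      unwrap (≃-trans (row a k)
        (≃-trans (*ᴿ-cong {sign sᴿ a} ≃-refl (wrap (v≈ k))) (≃-sym (linComb-at c a k))))
      where
      row : ∀ a k → v (at a k) ≃ sign sᴿ a *ᴿ v (at zero k)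
      row zero k = ≃-sym (1*-cancel (v (at zero k)))
      row (suc zero) k = second-row v eigen k

basis-vector : ∀ {n d} {V : Vector ℝ n → Set} → HasDimension V (suc d) →
  ∃[ v ] (¬ (v ≈ᵛ 0ᵛ) × V v)
basis-vector (b , basis) = b zero , b₀≉0 , IsBasis.member basis zero
  where
  b₀≉0 : ¬ (b zero ≈ᵛ 0ᵛ)
  b₀≉0 b₀≈0 = contradiction
    (fromℤ-injective {+ 1} {+ 0}
      (wrap (IsBasis.independent basis (δ zero) combination-zero zero)))
    λ ()
    where
    combination-zero : linComb (δ zero) b ≈ᵛ 0ᵛ
    combination-zero i = unwrap {linComb (δ zero) b i} {0ℝ}
      (by-combination₂ 1ℝ 1ℝ (wrap {b zero i} {0ℝ} (b₀≈0 i))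
      (∑-0 (λ j → 0ℝ *ᴿ b (suc j) i) λ j → pointwise λ n → ℚ.*-zeroˡ (seq (b (suc j) i) n)) λ n →
      solve 2 (λ x s → con 1ℚ :* x :+ s :- con 0ℚ :=
        con 1ℚ :* (x :- con 0ℚ) :+ con 1ℚ :* (s :- con 0ℚ)) refl
        (seq (b zero i) n) (seq (∑ λ j → 0ℝ *ᴿ b (suc j) i) n))

module _ (m : ℕ) where

  rookEigenvalue : Fin 4 → ℤ
  rookEigenvalue zero = + (3 ℕ.+ m)
  rookEigenvalue (suc zero) = + (1 ℕ.+ m)
  rookEigenvalue (suc (suc zero)) = + 0
  rookEigenvalue (suc (suc (suc zero))) = -[1+ 1 ]

  rookMultiplicity-1 : Fin 4 → ℕ
  rookMultiplicity-1 zero = 0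
  rookMultiplicity-1 (suc zero) = 0
  rookMultiplicity-1 (suc (suc i)) = 1 ℕ.+ m

  rookEigenvalue-injective : Injective _≡_ _≡_ rookEigenvalue
  rookEigenvalue-injective {zero} {zero} _ = refl
  rookEigenvalue-injective {zero} {suc zero} ()
  rookEigenvalue-injective {zero} {suc (suc zero)} ()
  rookEigenvalue-injective {zero} {suc (suc (suc zero))} ()
  rookEigenvalue-injective {suc zero} {zero} ()
  rookEigenvalue-injective {suc zero} {suc zero} _ = refl
  rookEigenvalue-injective {suc zero} {suc (suc zero)} ()
  rookEigenvalue-injective {suc zero} {suc (suc (suc zero))} ()
  rookEigenvalue-injective {suc (suc zero)} {zero} ()
  rookEigenvalue-injective {suc (suc zero)} {suc zero} ()
  rookEigenvalue-injective {suc (suc zero)} {suc (suc zero)} _ = refl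
  rookEigenvalue-injective {suc (suc zero)} {suc (suc (suc zero))} ()
  rookEigenvalue-injective {suc (suc (suc zero))} {zero} ()
  rookEigenvalue-injective {suc (suc (suc zero))} {suc zero} ()
  rookEigenvalue-injective {suc (suc (suc zero))} {suc (suc zero)} ()
  rookEigenvalue-injective {suc (suc (suc zero))} {suc (suc (suc zero))} _ = refl

  module _ {n} {A : Matrix n} (R : RookMatrix A (3 ℕ.+ m)) where
    open RookMatrix R

    rook-dimension : ∀ i →
      HasDimension (Eigenspace A (fromℤ (rookEigenvalue i))) (suc (rookMultiplicity-1 i))
    rook-dimension zero = unfold-dimension R (+ (3 ℕ.+ m)) (+ 1) (+ (3 ℕ.+ m)) refl refl
      (λ eq → ℕ.m+1+n≢m m (ℕ.suc-injective (ℕ.suc-injective (ℕ.suc-injective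
        (trans (sym (ℕ.+-assoc (3 ℕ.+ m) 1 1)) (ℤ.+-injective eq))))))
      (λ ()) (ones-dimension-m (2 ℕ.+ m))
    rook-dimension (suc zero) = unfold-dimension R (+ (1 ℕ.+ m)) -[1+ 0 ] (+ (3 ℕ.+ m))
      refl (cong (+_ ∘ suc) (ℕ.+-comm m 1)) (λ ()) (λ ()) (ones-dimension-m (2 ℕ.+ m))
    rook-dimension (suc (suc zero)) = unfold-dimension R (+ 0) (+ 1) (+ 0) refl refl
      (λ ()) (λ ()) (ones-dimension-0 (2 ℕ.+ m))
    rook-dimension (suc (suc (suc zero))) = unfold-dimension R -[1+ 1 ] -[1+ 0 ] (+ 0) refl refl
      (λ ()) (λ ()) (ones-dimension-0 (2 ℕ.+ m))

    eigenvector-zero : ∀ {μ v} → (∀ i → ¬ (μ ≃ fromℤ (rookEigenvalue i))) →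
      Eigenspace A μ v → v ≈ᵛ 0ᵛ
    eigenvector-zero {μ} {v} μ≄ eigen = at-cell (λ e → v e ≈ᴿ 0ℝ) λ a k → unwrap (row a k)
      where
      fold₊ : ∀ k → v (at zero k) +ᴿ 1ℝ *ᴿ v (at (suc zero) k) ≃ 0ℝ
      fold₊ = fold-zero R {μ} {v} (pointwise λ _ → refl) eigen
        (μ≄ zero ∘ ≃-trans (≃-sym shift)) (μ≄ (suc (suc zero)) ∘ ≃-trans (≃-sym shift))
        where
        shift : μ +ᴿ 1ℝ -ᴿ 1ℝ ≃ μ
        shift = pointwise λ n →
          solve 1 (λ μ → μ :+ con 1ℚ :+ con (ℚ.- 1ℚ) :* con 1ℚ := μ) refl (seq μ n)
      fold₋ : ∀ k → v (at zero k) +ᴿ -1ℝ *ᴿ v (at (suc zero) k) ≃ 0ℝ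
      fold₋ = fold-zero R {μ} {v} (pointwise λ _ → refl) eigen
        (λ eq → μ≄ (suc zero) (by-combination₂ 1ℝ 1ℝ eq (fromℤ-homo-+ (+ 2) (+ (1 ℕ.+ m)))
          λ n → solve 3 (λ μ u w → μ :- w :=
              con 1ℚ :* (μ :+ con 1ℚ :+ con (ℚ.- 1ℚ) :* con (ℚ.- 1ℚ) :- u) :+
              con 1ℚ :* (u :- (con (+ 2 ℚ./ 1) :+ w))) refl
            (seq μ n) (+ (3 ℕ.+ m) ℚ./ 1) (+ (1 ℕ.+ m) ℚ./ 1)))
        (λ eq → μ≄ (suc (suc (suc zero))) (by-combination₁ 1ℝ eq λ n →
          solve 1 (λ μ → μ :- con (-[1+ 1 ] ℚ./ 1) :=
            con 1ℚ :* (μ :+ con 1ℚ :+ con (ℚ.- 1ℚ) :* con (ℚ.- 1ℚ) :- con 0ℚ)) refl (seq μ n)))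
      row : ∀ a k → v (at a k) ≃ 0ℝ
      row zero k = by-combination₂ (fromℚ ½) (fromℚ ½) (fold₊ k) (fold₋ k) λ n →
        solve 2 (λ x y → x :- con 0ℚ :=
          con ½ :* (x :+ con 1ℚ :* y :- con 0ℚ) :+
          con ½ :* (x :+ con (ℚ.- 1ℚ) :* y :- con 0ℚ)) refl
          (seq (v (at zero k)) n) (seq (v (at (suc zero) k)) n)
      row (suc zero) k = by-combination₂ (fromℚ ½) (fromℚ (ℚ.- ½)) (fold₊ k) (fold₋ k) λ n →
        solve 2 (λ x y → y :- con 0ℚ :=
          con ½ :* (x :+ con 1ℚ :* y :- con 0ℚ) :+
          con (ℚ.- ½) :* (x :+ con (ℚ.- 1ℚ) :* y :- con 0ℚ)) refl
          (seq (v (at zero k)) n) (seq (v (at (suc zero) k)) n)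

    rook-spectrum : Spectrum A
    rook-spectrum = record
      { size = 4
      ; eigenvalue = fromℤ ∘ rookEigenvalue
      ; multiplicity = suc ∘ rookMultiplicity-1
      ; distinct = λ i≢j eq → i≢j (rookEigenvalue-injective (fromℤ-injective (wrap eq)))
      ; complete = λ μ → mk⇔ (find μ) (is-eigenvalue μ)
      ; dimension = rook-dimension
      }
      where
      find : ∀ μ → IsEigenvalue A μ → ∃[ i ] (μ ≈ᴿ fromℤ (rookEigenvalue i))
      find μ (v , v≉0 , eigen) = map₂ unwrap (locate (λ i → rookEigenvalue i ℚ./ 1)
        (rookEigenvalue-injective ∘ /1-injective) μ
        λ μ≄ → v≉0 (eigenvector-zero {μ} {v} μ≄ eigen))
      is-eigenvalue : ∀ μ → ∃[ i ] (μ ≈ᴿ fromℤ (rookEigenvalue i)) → IsEigenvalue A μ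
      is-eigenvalue μ (i , μ≈) = map₂ (map₂ transport) (basis-vector (rook-dimension i))
        where
        transport : ∀ {v} → Eigenspace A (fromℤ (rookEigenvalue i)) v → Eigenspace A μ v
        transport {v} eigen e = unwrap (≃-trans
          (wrap {(A ·ᴹ v) e} {fromℤ (rookEigenvalue i) *ᴿ v e} (eigen e))
          (*ᴿ-cong {u = v e} (≃-sym (wrap {μ} μ≈)) ≃-refl))

    rook-energy : sumOfAbsoluteValues rook-spectrum ≈ᴿ fromℤ (+ (4 * (4 ℕ.+ m)) - + 3 - + 5)
    rook-energy = unwrap {sumOfAbsoluteValues rook-spectrum} {fromℤ (+ (4 * (4 ℕ.+ m)) - + 3 - + 5)}
      (pointwise λ _ → energy)
      where
      u : ℚ
      u = + m ℚ./ 1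
      ∣k+m∣ : ∀ k → ℚ.∣ + (k ℕ.+ m) ℚ./ 1 ∣ ≡ + k ℚ./ 1 ℚ.+ u
      ∣k+m∣ k = trans (ℚ.0≤p⇒∣p∣≡p (ℚ.nonNegative⁻¹ (+ (k ℕ.+ m) ℚ./ 1)
        {{ℚ.normalize-nonNeg (k ℕ.+ m) 1}})) (/1-homo-+ (+ k) (+ m))
      weigh : ℚ → ℚ → ℚ → ℚ
      weigh a b c = 1ℚ ℚ.* a ℚ.+ (1ℚ ℚ.* b ℚ.+ (c ℚ.* 0ℚ ℚ.+ (c ℚ.* (+ 2 ℚ./ 1) ℚ.+ 0ℚ)))
      4[4+m]-3-5 : (+ (4 * (4 ℕ.+ m)) - + 3 - + 5) ℚ./ 1 ≡
        + 4 ℚ./ 1 ℚ.* (+ 4 ℚ./ 1 ℚ.+ u) ℚ.+ -[1+ 2 ] ℚ./ 1 ℚ.+ -[1+ 4 ] ℚ./ 1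
      4[4+m]-3-5 = begin
        (+ (4 * (4 ℕ.+ m)) - + 3 - + 5) ℚ./ 1
          ≡⟨ /1-homo-+ (+ (4 * (4 ℕ.+ m)) - + 3) -[1+ 4 ] ⟩
        (+ (4 * (4 ℕ.+ m)) - + 3) ℚ./ 1 ℚ.+ -[1+ 4 ] ℚ./ 1
          ≡⟨ cong (ℚ._+ -[1+ 4 ] ℚ./ 1) (/1-homo-+ (+ (4 * (4 ℕ.+ m))) -[1+ 2 ]) ⟩
        + (4 * (4 ℕ.+ m)) ℚ./ 1 ℚ.+ -[1+ 2 ] ℚ./ 1 ℚ.+ -[1+ 4 ] ℚ./ 1
          ≡⟨ cong (λ x → x ℚ.+ -[1+ 2 ] ℚ./ 1 ℚ.+ -[1+ 4 ] ℚ./ 1) product ⟩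
        + 4 ℚ./ 1 ℚ.* (+ 4 ℚ./ 1 ℚ.+ u) ℚ.+ -[1+ 2 ] ℚ./ 1 ℚ.+ -[1+ 4 ] ℚ./ 1 ∎
        where
        open ≡-Reasoning
        product : + (4 * (4 ℕ.+ m)) ℚ./ 1 ≡ + 4 ℚ./ 1 ℚ.* (+ 4 ℚ./ 1 ℚ.+ u)
        product = begin
          + (4 * (4 ℕ.+ m)) ℚ./ 1               ≡⟨ cong (ℚ._/ 1) (ℤ.pos-* 4 (4 ℕ.+ m)) ⟩
          (+ 4 ℤ.* + (4 ℕ.+ m)) ℚ./ 1           ≡⟨ /1-homo-* (+ 4) (+ (4 ℕ.+ m)) ⟩
          + 4 ℚ./ 1 ℚ.* (+ (4 ℕ.+ m) ℚ./ 1)     ≡⟨ cong (+ 4 ℚ./ 1 ℚ.*_) (/1-homo-+ (+ 4) (+ m)) ⟩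
          + 4 ℚ./ 1 ℚ.* (+ 4 ℚ./ 1 ℚ.+ u)       ∎
      energy : weigh ℚ.∣ + (3 ℕ.+ m) ℚ./ 1 ∣ ℚ.∣ + (1 ℕ.+ m) ℚ./ 1 ∣ (+ (2 ℕ.+ m) ℚ./ 1) ≡
        (+ (4 * (4 ℕ.+ m)) - + 3 - + 5) ℚ./ 1
      energy = begin
        weigh ℚ.∣ + (3 ℕ.+ m) ℚ./ 1 ∣ ℚ.∣ + (1 ℕ.+ m) ℚ./ 1 ∣ (+ (2 ℕ.+ m) ℚ./ 1)
          ≡⟨ cong₂ (λ a b → weigh a b (+ (2 ℕ.+ m) ℚ./ 1)) (∣k+m∣ 3) (∣k+m∣ 1) ⟩
        weigh (+ 3 ℚ./ 1 ℚ.+ u) (1ℚ ℚ.+ u) (+ (2 ℕ.+ m) ℚ./ 1)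
          ≡⟨ cong (weigh (+ 3 ℚ./ 1 ℚ.+ u) (1ℚ ℚ.+ u)) (/1-homo-+ (+ 2) (+ m)) ⟩
        weigh (+ 3 ℚ./ 1 ℚ.+ u) (1ℚ ℚ.+ u) (+ 2 ℚ./ 1 ℚ.+ u)
          ≡⟨ solve 1 (λ u → con 1ℚ :* (con (+ 3 ℚ./ 1) :+ u) :+ (con 1ℚ :* (con 1ℚ :+ u) :+
               ((con (+ 2 ℚ./ 1) :+ u) :* con 0ℚ :+
                 ((con (+ 2 ℚ./ 1) :+ u) :* con (+ 2 ℚ./ 1) :+ con 0ℚ))) :=
               con (+ 4 ℚ./ 1) :* (con (+ 4 ℚ./ 1) :+ u) :+ con (-[1+ 2 ] ℚ./ 1) :+
                 con (-[1+ 4 ] ℚ./ 1)) refl u ⟩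
        + 4 ℚ./ 1 ℚ.* (+ 4 ℚ./ 1 ℚ.+ u) ℚ.+ -[1+ 2 ] ℚ./ 1 ℚ.+ -[1+ 4 ] ℚ./ 1
          ≡⟨ 4[4+m]-3-5 ⟨
        (+ (4 * (4 ℕ.+ m)) - + 3 - + 5) ℚ./ 1 ∎
        where open ≡-Reasoning

-- Line graphs of complete bipartite graphs

lookup-injective : ∀ {A : Set} {xs : List A} → Unique xs → Injective _≡_ _≡_ (lookup xs)
lookup-injective (_ ∷ _) {zero} {zero} _ = refl
lookup-injective (x∉ ∷ _) {zero} {suc j} eq = contradiction eq (All.lookup x∉ (∈-lookup j))
lookup-injective (x∉ ∷ _) {suc i} {zero} eq = contradiction (sym eq) (All.lookup x∉ (∈-lookup i))
lookup-injective (_ ∷ unique) {suc i} {suc j} eq = cong suc (lookup-injective unique eq)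

δ-yes : ∀ {n} {i j : Fin n} → i ≡ j → δ i j ≡ 1ℝ
δ-yes {i = i} {j} i≡j = cong (if_then 1ℝ else 0ℝ) (dec-true (i ≟ᶠ j) i≡j)

δ-no : ∀ {n} {i j : Fin n} → i ≢ j → δ i j ≡ 0ℝ
δ-no {i = i} {j} i≢j = cong (if_then 1ℝ else 0ℝ) (dec-false (i ≟ᶠ j) i≢j)

record CompleteBipartite (G : Graph) (r m : ℕ) : Set where
  open Graph G using (Adj)
  field
    left : Fin r → Fin (order G)
    right : Fin m → Fin (order G)
    left-injective : Injective _≡_ _≡_ left
    right-injective : Injective _≡_ _≡_ right
    left≢right : ∀ a k → left a ≢ right k
    left-adj-right : ∀ a k → Adj (left a) (right k)

  Joins : Fin (order G) × Fin (order G) → Fin r × Fin m → Set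
  Joins (i , j) (a , k) = (i ≡ left a × j ≡ right k) ⊎ (i ≡ right k × j ≡ left a)

  field
    adj⇒joins : ∀ {i j} → Adj i j → ∃[ c ] Joins (i , j) c

module _ {G : Graph} {r m : ℕ} (K : CompleteBipartite G r m) where
  open Graph G using (Adj; adj?; symm)
  open CompleteBipartite K

  joins-share : ∀ {p p′ a b k l} → Joins p (a , k) → Joins p′ (b , l) →
    ShareVertex G p p′ → a ≡ b ⊎ k ≡ l
  joins-share (inj₁ (refl , refl)) (inj₁ (refl , refl)) = λ where
    (inj₁ (inj₁ eq)) → inj₁ (left-injective eq)
    (inj₁ (inj₂ eq)) → contradiction eq (left≢right _ _)
    (inj₂ (inj₁ eq)) → contradiction (sym eq) (left≢right _ _)
    (inj₂ (inj₂ eq)) → inj₂ (right-injective eq)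
  joins-share (inj₁ (refl , refl)) (inj₂ (refl , refl)) = λ where
    (inj₁ (inj₁ eq)) → contradiction eq (left≢right _ _)
    (inj₁ (inj₂ eq)) → inj₁ (left-injective eq)
    (inj₂ (inj₁ eq)) → inj₂ (right-injective eq)
    (inj₂ (inj₂ eq)) → contradiction (sym eq) (left≢right _ _)
  joins-share (inj₂ (refl , refl)) (inj₁ (refl , refl)) = λ where
    (inj₁ (inj₁ eq)) → contradiction (sym eq) (left≢right _ _)
    (inj₁ (inj₂ eq)) → inj₂ (right-injective eq)
    (inj₂ (inj₁ eq)) → inj₁ (left-injective eq)
    (inj₂ (inj₂ eq)) → contradiction eq (left≢right _ _)
  joins-share (inj₂ (refl , refl)) (inj₂ (refl , refl)) = λ where
    (inj₁ (inj₁ eq)) → inj₂ (right-injective eq)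
    (inj₁ (inj₂ eq)) → contradiction (sym eq) (left≢right _ _)
    (inj₂ (inj₁ eq)) → contradiction eq (left≢right _ _)
    (inj₂ (inj₂ eq)) → inj₁ (left-injective eq)

  share-left : ∀ {p p′ a k l} → Joins p (a , k) → Joins p′ (a , l) → ShareVertex G p p′
  share-left (inj₁ (refl , _)) (inj₁ (refl , _)) = inj₁ (inj₁ refl)
  share-left (inj₁ (refl , _)) (inj₂ (_ , refl)) = inj₁ (inj₂ refl)
  share-left (inj₂ (_ , refl)) (inj₁ (refl , _)) = inj₂ (inj₁ refl)
  share-left (inj₂ (_ , refl)) (inj₂ (_ , refl)) = inj₂ (inj₂ refl)

  share-right : ∀ {p p′ a b k} → Joins p (a , k) → Joins p′ (b , k) → ShareVertex G p p′
  share-right (inj₁ (_ , refl)) (inj₁ (_ , refl)) = inj₂ (inj₂ refl)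
  share-right (inj₁ (_ , refl)) (inj₂ (refl , _)) = inj₂ (inj₁ refl)
  share-right (inj₂ (refl , _)) (inj₁ (_ , refl)) = inj₁ (inj₂ refl)
  share-right (inj₂ (refl , _)) (inj₂ (refl , _)) = inj₁ (inj₁ refl)

  joins-functional : ∀ {p c c′} → Joins p c → Joins p c′ → c ≡ c′
  joins-functional (inj₁ (refl , refl)) (inj₁ (eq , eq′)) =
    cong₂ _,_ (left-injective eq) (right-injective eq′)
  joins-functional (inj₁ (refl , refl)) (inj₂ (eq , _)) = contradiction eq (left≢right _ _)
  joins-functional (inj₂ (refl , refl)) (inj₁ (eq , _)) =
    contradiction (sym eq) (left≢right _ _)
  joins-functional (inj₂ (refl , refl)) (inj₂ (eq , eq′)) =
    cong₂ _,_ (left-injective eq′) (right-injective eq)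

  joins-injective : ∀ {i j i′ j′ c} → i <ᶠ j → i′ <ᶠ j′ → Joins (i , j) c → Joins (i′ , j′) c →
    (i , j) ≡ (i′ , j′)
  joins-injective _ _ (inj₁ (refl , refl)) (inj₁ (refl , refl)) = refl
  joins-injective i<j i′<j′ (inj₁ (refl , refl)) (inj₂ (refl , refl)) =
    contradiction i′<j′ (ℕ.<-asym i<j)
  joins-injective i<j i′<j′ (inj₂ (refl , refl)) (inj₁ (refl , refl)) =
    contradiction i′<j′ (ℕ.<-asym i<j)
  joins-injective _ _ (inj₂ (refl , refl)) (inj₂ (refl , refl)) = refl

  edge? : ∀ p → Dec (proj₁ p <ᶠ proj₂ p × uncurry Adj p)
  edge? (i , j) = (i <ᶠ? j) ×-dec adj? i j

  edges-unique : Unique (edges G)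
  edges-unique = filter⁺ edge? (cartesianProduct⁺ (allFin⁺ (order G)) (allFin⁺ (order G)))

  edge-sound : ∀ e → proj₁ (lookup (edges G) e) <ᶠ proj₂ (lookup (edges G) e) ×
    uncurry Adj (lookup (edges G) e)
  edge-sound e = proj₂ (∈-filter⁻ edge?
    {xs = cartesianProduct (allFin (order G)) (allFin (order G))} (∈-lookup e))

  edge-complete : ∀ i j → i <ᶠ j → Adj i j → ∃[ e ] (lookup (edges G) e ≡ (i , j))
  edge-complete i j i<j i~j = Any.index ij∈ , sym (lookup-index ij∈)
    where
    ij∈ : (i , j) ∈ edges G
    ij∈ = ∈-filter⁺ edge? (∈-cartesianProduct⁺ (∈-allFin i) (∈-allFin j)) (i<j , i~j)

  edge-cell : ∀ e → ∃[ c ] Joins (lookup (edges G) e) c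
  edge-cell e = adj⇒joins (proj₂ (edge-sound e))

  cell-edge : ∀ c → ∃[ e ] Joins (lookup (edges G) e) c
  cell-edge (a , k) with <-cmp (left a) (right k)
  ... | tri< l<r _ _ = map₂ (λ eq → subst (λ p → Joins p (a , k)) (sym eq) (inj₁ (refl , refl)))
    (edge-complete (left a) (right k) l<r (left-adj-right a k))
  ... | tri≈ _ l≡r _ = contradiction l≡r (left≢right a k)
  ... | tri> _ _ r<l = map₂ (λ eq → subst (λ p → Joins p (a , k)) (sym eq) (inj₂ (refl , refl)))
    (edge-complete (right k) (left a) r<l (symm (left-adj-right a k)))

  edges-same-cell : ∀ {e f c} → Joins (lookup (edges G) e) c → Joins (lookup (edges G) f) c →
    e ≡ f
  edges-same-cell {e} {f} e∋c f∋c = lookup-injective edges-unique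
    (joins-injective (proj₁ (edge-sound e)) (proj₁ (edge-sound f)) e∋c f∋c)

  edges↔cells : Fin (length (edges G)) ↔ (Fin r × Fin m)
  edges↔cells = mk↔ₛ′ (proj₁ ∘ edge-cell) (proj₁ ∘ cell-edge)
    (λ c → joins-functional (proj₂ (edge-cell (proj₁ (cell-edge c)))) (proj₂ (cell-edge c)))
    (λ e → edges-same-cell (proj₂ (cell-edge (proj₁ (edge-cell e)))) (proj₂ (edge-cell e)))

  lineGraph-adjacency : ∀ e f → adjacencyMatrix (lineGraph G) e f ≃
    rookEntry (Inverse.to edges↔cells e) (Inverse.to edges↔cells f)
  lineGraph-adjacency e f = entry (proj₂ (edge-cell e)) (proj₂ (edge-cell f))
    where
    open Graph (lineGraph G) using () renaming (Adj to Adjᴸ; adj? to adjᴸ?)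
    value : ∀ (a b : Fin r) (k l : Fin m) {x α β} → adjacencyMatrix (lineGraph G) e f ≡ x →
      δ a b ≡ α → δ k l ≡ β → x ≃ α +ᴿ β +ᴿ -2ℝ *ᴿ (α *ᴿ β) →
      adjacencyMatrix (lineGraph G) e f ≃ rookEntry (a , k) (b , l)
    value a b k l x≡ α≡ β≡ = subst₂ _≃_ (sym x≡)
      (sym (cong₂ (λ α β → α +ᴿ β +ᴿ -2ℝ *ᴿ (α *ᴿ β)) α≡ β≡))
    adjacent : Adjᴸ e f → adjacencyMatrix (lineGraph G) e f ≡ 1ℝ
    adjacent = cong (if_then 1ℝ else 0ℝ) ∘ dec-true (adjᴸ? e f)
    nonadjacent : ¬ Adjᴸ e f → adjacencyMatrix (lineGraph G) e f ≡ 0ℝ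
    nonadjacent = cong (if_then 1ℝ else 0ℝ) ∘ dec-false (adjᴸ? e f)
    entry : ∀ {c d} → Joins (lookup (edges G) e) c → Joins (lookup (edges G) f) d →
      adjacencyMatrix (lineGraph G) e f ≃ rookEntry c d
    entry {a , k} {b , l} e∋c f∋d = by-cases (a ≟ᶠ b) (k ≟ᶠ l)
      where
      by-cases : Dec (a ≡ b) → Dec (k ≡ l) →
        adjacencyMatrix (lineGraph G) e f ≃ rookEntry (a , k) (b , l)
      by-cases (yes refl) (yes refl) =
        value a a k k (nonadjacent λ (e≢f , _) → e≢f (edges-same-cell e∋c f∋d))
          (δ-yes {i = a} refl) (δ-yes {i = k} refl) (pointwise λ _ → refl)
      by-cases (yes refl) (no k≢l) =
        value a a k l
          (adjacent ((λ { refl → k≢l (cong proj₂ (joins-functional e∋c f∋d)) }) ,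
                     share-left e∋c f∋d))
          (δ-yes {i = a} refl) (δ-no k≢l) (pointwise λ _ → refl)
      by-cases (no a≢b) (yes refl) =
        value a b k k
          (adjacent ((λ { refl → a≢b (cong proj₁ (joins-functional e∋c f∋d)) }) ,
                     share-right e∋c f∋d))
          (δ-no a≢b) (δ-yes {i = k} refl) (pointwise λ _ → refl)
      by-cases (no a≢b) (no k≢l) =
        value a b k l
          (nonadjacent λ (_ , share) → [ a≢b , k≢l ]′ (joins-share e∋c f∋d share))
          (δ-no a≢b) (δ-no k≢l) (pointwise λ _ → refl)

lineGraph-rook : ∀ {G m} → CompleteBipartite G 2 m →
  RookMatrix (adjacencyMatrix (lineGraph G)) m
lineGraph-rook K = record { cells = edges↔cells K ; entry = lineGraph-adjacency K }


-- The zero-divisor graph of ℤ/3q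

*ₙ-zero⇒∣ : ∀ {n} (x y : Fin n) → IsZero (x *ₙ y) → n ∣ toℕ x * toℕ y
*ₙ-zero⇒∣ {n} x y xy≡0 = m%n≡0⇒n∣m (toℕ x * toℕ y) n {{nonZeroIndex x}}
  (trans (sym (toℕ-fromℕ< (m%n<n (toℕ x * toℕ y) n {{nonZeroIndex x}}))) xy≡0)

∣⇒*ₙ-zero : ∀ {n} (x y : Fin n) → n ∣ toℕ x * toℕ y → IsZero (x *ₙ y)
∣⇒*ₙ-zero {n} x y n∣xy = trans (toℕ-fromℕ< (m%n<n (toℕ x * toℕ y) n {{nonZeroIndex x}}))
  (n∣m⇒m%n≡0 (toℕ x * toℕ y) n {{nonZeroIndex x}} n∣xy)

module _ (n : ℕ) where

  value : Fin (length (nonzeroZeroDivisors n)) → ℕ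
  value i = toℕ (lookup (nonzeroZeroDivisors n) i)

  value-injective : Injective _≡_ _≡_ value
  value-injective = lookup-injective (filter⁺ isNonzeroZeroDivisor? (allFin⁺ n)) ∘ toℕ-injective

  value<n : ∀ i → value i < n
  value<n i = toℕ<n (lookup (nonzeroZeroDivisors n) i)

  value≢0 : ∀ i → value i ≢ 0
  value≢0 i = proj₁ (proj₂ (∈-filter⁻ isNonzeroZeroDivisor? {xs = allFin n} (∈-lookup i)))

  zero-divisor : ∀ {v w} → v < n → v ≢ 0 → w < n → w ≢ 0 → n ∣ v * w → ∃[ i ] (value i ≡ v)
  zero-divisor {v} {w} v<n v≢0 w<n w≢0 n∣vw =
    Any.index x∈ , trans (cong toℕ (sym (lookup-index x∈))) (toℕ-fromℕ< v<n)
    where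
    x y : Fin n
    x = fromℕ< v<n
    y = fromℕ< w<n
    x∈ : x ∈ nonzeroZeroDivisors n
    x∈ = ∈-filter⁺ isNonzeroZeroDivisor? (∈-allFin x)
      ( v≢0 ∘ trans (sym (toℕ-fromℕ< v<n))
      , y
      , w≢0 ∘ trans (sym (toℕ-fromℕ< w<n))
      , ∣⇒*ₙ-zero x y (subst (n ∣_) (sym (cong₂ _*_ (toℕ-fromℕ< v<n) (toℕ-fromℕ< w<n))) n∣vw)
      )

prime[3] : Prime 3
prime[3] = from-yes (prime? 3)

nonzero⇒suc : ∀ {c n} → c ≢ 0 → c < suc n → ∃[ k ] (suc (toℕ {n} k) ≡ c)
nonzero⇒suc {zero} c≢0 _ = contradiction refl c≢0
nonzero⇒suc {suc c} _ (s≤s c<n) = fromℕ< c<n , cong suc (toℕ-fromℕ< c<n)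

module _ {q m : ℕ} (q-prime : Prime q) (3<q : 3 < q) (1+m≡q : suc m ≡ q) where

  private instance
    q-nonZero : ℕ.NonZero q
    q-nonZero = prime⇒nonZero q-prime

  3∣∧q∣⇒3q∣ : ∀ {v} → 3 ∣ v → q ∣ v → 3 * q ∣ v
  3∣∧q∣⇒3q∣ 3∣v (divides c refl) with euclidsLemma c q prime[3] 3∣v
  ... | inj₁ 3∣c = *-monoˡ-∣ q 3∣c
  ... | inj₂ 3∣q with prime⇒irreducible q-prime 3∣q
  ... | inj₁ ()
  ... | inj₂ 3≡q = contradiction 3≡q (ℕ.<⇒≢ 3<q)

  1+k<q : (k : Fin m) → suc (toℕ k) < q
  1+k<q k = subst (suc (toℕ k) <_) 1+m≡q (s≤s (toℕ<n k))

  3q∣[1+a]q*3 : ∀ a → 3 * q ∣ suc a * q * 3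
  3q∣[1+a]q*3 a = divides (suc a) (trans (ℕ.*-assoc (suc a) q 3) (cong (suc a *_) (ℕ.*-comm q 3)))

  left-vertex : (a : Fin 2) → ∃[ i ] (value (3 * q) i ≡ suc (toℕ a) * q)
  left-vertex a = zero-divisor (3 * q) (ℕ.*-monoˡ-< q (s≤s (toℕ<n a)))
    (ℕ.≢-nonZero⁻¹ (suc (toℕ a) * q) {{ℕ.m*n≢0 (suc (toℕ a)) q}})
    (ℕ.<-≤-trans 3<q (ℕ.m≤n*m q 3)) (λ ()) (3q∣[1+a]q*3 (toℕ a))

  right-vertex : (k : Fin m) → ∃[ i ] (value (3 * q) i ≡ 3 * suc (toℕ k))
  right-vertex k = zero-divisor (3 * q) (ℕ.*-monoʳ-< 3 (1+k<q k)) (λ ())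
    (subst (_< 3 * q) (ℕ.*-identityˡ q) (ℕ.*-monoˡ-< q {1} {3} (s≤s (s≤s z≤n))))
    (ℕ.≢-nonZero⁻¹ q)
    (divides (suc (toℕ k)) (trans (cong (_* q) (ℕ.*-comm 3 (suc (toℕ k))))
      (ℕ.*-assoc (suc (toℕ k)) 3 q)))

  left-of : ∀ i → q ∣ value (3 * q) i → ∃[ a ] (i ≡ proj₁ (left-vertex a))
  left-of i (divides c v≡cq) = map₂ (λ {a} 1+a≡c → value-injective (3 * q)
      (trans v≡cq (trans (cong (_* q) (sym 1+a≡c)) (sym (proj₂ (left-vertex a))))))
    (nonzero⇒suc (λ { refl → value≢0 (3 * q) i v≡cq })
      (ℕ.*-cancelʳ-< q c 3 (subst (_< 3 * q) v≡cq (value<n (3 * q) i))))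

  right-of : ∀ i → 3 ∣ value (3 * q) i → ∃[ k ] (i ≡ proj₁ (right-vertex k))
  right-of i (divides c v≡c3) = map₂ (λ {k} 1+k≡c → value-injective (3 * q)
      (trans v≡3c (trans (cong (3 *_) (sym 1+k≡c)) (sym (proj₂ (right-vertex k))))))
    (nonzero⇒suc (λ { refl → value≢0 (3 * q) i v≡c3 })
      (subst (c <_) (sym 1+m≡q) (ℕ.*-cancelˡ-< 3 c q (subst (_< 3 * q) v≡3c (value<n (3 * q) i)))))
    where
    v≡3c : value (3 * q) i ≡ 3 * c
    v≡3c = trans v≡c3 (ℕ.*-comm c 3)

  zeroDivisorGraph-bipartite : CompleteBipartite (zeroDivisorGraph (3 * q)) 2 m
  zeroDivisorGraph-bipartite = record
    { left = left
    ; right = right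
    ; left-injective = λ {a} {b} eq → toℕ-injective (ℕ.suc-injective
        (ℕ.*-cancelʳ-≡ (suc (toℕ a)) (suc (toℕ b)) q
          (trans (sym (left-value a)) (trans (cong (value (3 * q)) eq) (left-value b)))))
    ; right-injective = λ {k} {l} eq → toℕ-injective (ℕ.suc-injective
        (ℕ.*-cancelˡ-≡ (suc (toℕ k)) (suc (toℕ l)) 3
          (trans (sym (right-value k)) (trans (cong (value (3 * q)) eq) (right-value l)))))
    ; left≢right = left≢right
    ; left-adj-right = λ a k → left≢right a k ,
        ∣⇒*ₙ-zero (lookup (nonzeroZeroDivisors (3 * q)) (left a))
                  (lookup (nonzeroZeroDivisors (3 * q)) (right k))
          (subst (3 * q ∣_) (sym (cong₂ _*_ (left-value a) (right-value k)))
            (∣-trans (3q∣[1+a]q*3 (toℕ a)) (*-monoʳ-∣ (suc (toℕ a) * q) (m∣m*n (suc (toℕ k))))))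
    ; adj⇒joins = λ {i} {j} (_ , ij≡0) → joins i j
        (*ₙ-zero⇒∣ (lookup (nonzeroZeroDivisors (3 * q)) i)
                   (lookup (nonzeroZeroDivisors (3 * q)) j) ij≡0)
    }
    where
    left : Fin 2 → Fin (order (zeroDivisorGraph (3 * q)))
    left = proj₁ ∘ left-vertex
    right : Fin m → Fin (order (zeroDivisorGraph (3 * q)))
    right = proj₁ ∘ right-vertex
    left-value : ∀ a → value (3 * q) (left a) ≡ suc (toℕ a) * q
    left-value = proj₂ ∘ left-vertex
    right-value : ∀ k → value (3 * q) (right k) ≡ 3 * suc (toℕ k)
    right-value = proj₂ ∘ right-vertex
    left≢right : ∀ a k → left a ≢ right k
    left≢right a k eq = [ ℕ.<⇒≱ 3<q ∘ ∣⇒≤ , ℕ.<⇒≱ (1+k<q k) ∘ ∣⇒≤ ]′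
      (euclidsLemma 3 (suc (toℕ k)) q-prime (divides (suc (toℕ a))
        (trans (sym (right-value k)) (trans (cong (value (3 * q)) (sym eq)) (left-value a)))))
    Ends : Fin (order (zeroDivisorGraph (3 * q))) → Fin (order (zeroDivisorGraph (3 * q))) →
      Fin 2 × Fin m → Set
    Ends i j (a , k) = (i ≡ left a × j ≡ right k) ⊎ (i ≡ right k × j ≡ left a)
    joins : ∀ i j → 3 * q ∣ value (3 * q) i * value (3 * q) j → ∃[ c ] Ends i j c
    joins i j 3q∣ij = split
      (euclidsLemma (value (3 * q) i) (value (3 * q) j) prime[3] (m*n∣⇒m∣ 3 q 3q∣ij))
      (euclidsLemma (value (3 * q) i) (value (3 * q) j) q-prime (m*n∣⇒n∣ 3 q 3q∣ij))
      where
      not-both : ∀ i → 3 ∣ value (3 * q) i → ¬ (q ∣ value (3 * q) i)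
      not-both i 3∣i q∣i = ℕ.<⇒≱ (value<n (3 * q) i)
        (∣⇒≤ {{ℕ.≢-nonZero (value≢0 (3 * q) i)}} (3∣∧q∣⇒3q∣ 3∣i q∣i))
      split : 3 ∣ value (3 * q) i ⊎ 3 ∣ value (3 * q) j → q ∣ value (3 * q) i ⊎ q ∣ value (3 * q) j →
        ∃[ c ] Ends i j c
      split (inj₁ 3∣i) (inj₁ q∣i) = contradiction q∣i (not-both i 3∣i)
      split (inj₁ 3∣i) (inj₂ q∣j) =
        let (k , i≡) = right-of i 3∣i ; (a , j≡) = left-of j q∣j
        in (a , k) , inj₂ (i≡ , j≡)
      split (inj₂ 3∣j) (inj₁ q∣i) =
        let (k , j≡) = right-of j 3∣j ; (a , i≡) = left-of i q∣i
        in (a , k) , inj₁ (i≡ , j≡)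
      split (inj₂ 3∣j) (inj₂ q∣j) = contradiction q∣j (not-both j 3∣j)

theorem3p2 : ∀ (p q : ℕ) → p ≡ 3 → Prime q → 3 < q →
    HasEnergy (lineGraph (zeroDivisorGraph (3 * q))) (fromℤ (+ (4 * q) - + p - + 5))
theorem3p2 .3 q refl q-prime 3<q = rook-spectrum m rook ,
  subst (λ q → sumOfAbsoluteValues (rook-spectrum m rook) ≈ᴿ fromℤ (+ (4 * q) - + 3 - + 5)) 4+m≡q
    (rook-energy m rook)
  where
  m : ℕ
  m = q ℕ.∸ 4
  4+m≡q : 4 ℕ.+ m ≡ q
  4+m≡q = ℕ.m+[n∸m]≡n 3<q
  rook : RookMatrix (adjacencyMatrix (lineGraph (zeroDivisorGraph (3 * q)))) (3 ℕ.+ m)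
  rook = lineGraph-rook (zeroDivisorGraph-bipartite q-prime 3<q 4+m≡q)
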